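{- Let $n\ge2$, let $I$ be an ideal of $\Phi_{A_{n-1}}$ such that $I^c$ is full, and let $\mathcal{A}_I=\{\{x\in\mathbb{R}^n:x_i-x_j=0\}: e_i-e_j\in I^c\}$. Then $$T_{\mathcal{A}_I}(x,y)=\frac{1}{(y-1)^{n-1}}\sum_{i=1}^{n}\Big(\prod_{\substack{j\in[n]\\ j\ne i}}\frac{(x-1)(y-1)-\mathrm{p}(j)}{\mathrm{p}(i)-\mathrm{p}(j)}\Big)\,\bar\chi_{\mathcal{A}_I}(\mathrm{p}(i),y),$$ where, with $A^{(1)}|\dots|A^{(r)}$ the partition of $[n]$ in accordance with $I$ and $R^{(u)}=\{v\in\{u+1,\dots,r\}: s_I(A^{(u)})\cap s_I(A^{(v)})\ne\emptyset\}$, for every odd prime $p$ $$\bar\chi_{\mathcal{A}_I}(p,t)=\frac1p\sum_{(a^{(u)}_s)}\ \prod_{u=1}^r\binom{\#A^{(u)}}{a^{(u)}_1,\dots,a^{(u)}_p}\ \cdot\ t^{\sum_{u=1}^r\sum_{s=1}^p\left(\binom{a^{(u)}_s}{2}+a^{(u)}_s\sum_{v\in R^{(u)}}a^{(v)}_s\right)},$$ the sum running over all families of nonnegative integers $(a^{(u)}_s)_{u\in[r],\,s\in[p]}$ with $\sum_{s=1}^p a^{(u)}_s=\#A^{(u)}$ for each $u$.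
   Context: $\Phi^+_{A_{n-1}}=\{e_i-e_j:1\le i<j\le n\}$ with simple roots $e_i-e_{i+1}$. Partial order: $e_i-e_j\preceq e_{i'}-e_{j'}$ iff $i'\le i$ and $j\le j'$. An ideal is an up-closed subset $I\subseteq\Phi^+_{A_{n-1}}$; $I^c=\Phi^+_{A_{n-1}}\setminus I$; $I^c$ is full if it contains every simple root. Let $e_{i_1}-e_{j_1},\dots,e_{i_k}-e_{j_k}$ be the maximal elements of $I^c$; the signature of $u\in[n]$ is $s_I(u)=\{l\in[k]: i_l\le u\le j_l\}$. The partition in accordance with $I$ is the partition $A^{(1)}|\dots|A^{(r)}$ of $[n]$ into maximal nonempty subsets on which $s_I$ is constant, indexed by increasing minima; $s_I(A^{(u)})$ is the common signature. $\mathrm{r}(\mathcal{B})=n-\dim\bigcap\mathcal{B}$. Tutte polynomial: $T_{\mathcal{A}}(x,y)=\sum_{\mathcal{B}\subseteq\mathcal{A}}(x-1)^{\mathrm{r}(\mathcal{A})-\mathrm{r}(\mathcal{B})}(y-1)^{\#\mathcal{B}-\mathrm{r}(\mathcal{B})}$. Coboundary polynomial: $\bar\chi_{\mathcal{A}}(q,t)=\sum_{\mathcal{B}\subseteq\mathcal{A}}q^{\mathrm{r}(\mathcal{A})-\mathrm{r}(\mathcal{B})}(t-1)^{\#\mathcal{B}}$. For $i\ge1$, $\mathrm{p}(i)$ is the $i$-th odd prime ($\mathrm{p}(1)=3,\mathrm{p}(2)=5,\dots$). -}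

module Defs where

open import Algebra.Bundles using (CommutativeRing)
open import Algebra.Morphism.Structures using (module RingMorphisms)
open import Algebra.Structures using (IsCommutativeRing)
import Data.Bool.Properties as Bool
open import Data.Fin.Induction using (<-wellFounded)
open import Data.Fin.Base as Fin using (Fin; zero; suc; toℕ; punchIn; punchOut)
open import Data.Fin.Properties as Fin using (_≟_; _<?_; _≤?_; any?; punchOut-punchIn; punchInᵢ≢i)
open import Data.Fin.Subset using (Subset; _∈_; _⊆_; _∩_; Nonempty; ∣_∣; ⊤; inside; outside)
open import Data.Fin.Subset.Properties using (nonempty?; ⊆-antisym)
open import Data.Integer.Base using (ℤ; +_; -[1+_])
open import Data.List.Base as List
  using (List; []; _∷_; _++_; map; foldr; filter; concatMap; cartesianProductWith; allFin; upTo; length)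
import Data.List.Membership.Propositional as List
open import Data.List.Membership.Propositional.Properties
  using (∈-allFin; ∈-concatMap⁺; ∈-filter⁺; ∈-filter⁻; ∈-lookup)
open import Data.List.Relation.Unary.All as All using (All)
open import Data.List.Relation.Unary.AllPairs using (AllPairs; []; _∷_)
import Data.List.Relation.Unary.AllPairs.Properties as AllPairs
open import Data.List.Relation.Unary.Any as Any using (here)
import Data.List.Relation.Unary.Any.Properties as Any
open import Data.Nat.Base as ℕ using (ℕ; zero; suc; _∸_; _!)
open import Data.Nat.Divisibility using (_∣_; _∤_; ∣m+n∣m⇒∣n; ∣1⇒≡1; m≤n⇒m!∣n!; ∣-trans; m∣m*n)
open import Data.Nat.DivMod using (_/_)
open import Data.Nat.ListAction using (sum; product)
open import Data.Nat.Primality using (Prime; prime?; ¬prime[1]; prime⇒nonZero)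
open import Data.Nat.Primality.Factorisation using (PrimeFactorisation; factorise)
import Data.Nat.Properties as ℕ
open import Data.Product.Base using (Σ; ∃; _×_; _,_; proj₁; proj₂)
open import Data.Rational.Base as ℚ using (ℚ; 0ℚ; 1ℚ; ½)
import Data.Rational.Properties as ℚ
import Data.Rational.Solver as ℚ-Solver
open import Data.Sum.Base using (_⊎_; inj₁; inj₂)
open import Data.Vec.Base as Vec using (_∷_; [])
import Data.Vec.Properties as Vec
open import Data.Vec.Functional as F using (Vector)
open import Function.Base using (_∘_; id; case_of_)
open import Function.Bundles using (_⇔_; mk⇔)
open import Induction.WellFounded using (Acc; acc)
open import Level using (Level; 0ℓ; _⊔_) renaming (suc to lsuc)
open import Relation.Binary.PropositionalEquality
  using (_≡_; _≢_; refl; sym; trans; cong; subst)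
open import Relation.Nullary using (¬_; Dec; yes; no; does; contradiction)
open import Relation.Nullary.Decidable using (¬?; _×-dec_; _→-dec_; map′; dec-true)
open import Relation.Unary using (Pred; Decidable)

-- ℝ as Cauchy sequences of rationals; _≈ℝ_ is equality of the limits.
module Real where

  open import Data.Rational.Base using (_+_; _*_; _-_; -_; _<_) renaming (∣_∣ to ∣_∣ℚ)

  IsCauchy : (ℕ → ℚ) → Set
  IsCauchy x = ∀ ε → 0ℚ < ε → ∃ λ N → ∀ m n → N ℕ.≤ m → N ℕ.≤ n → ∣ x m - x n ∣ℚ < ε

  Close : (ℕ → ℚ) → (ℕ → ℚ) → Set
  Close x y = ∀ ε → 0ℚ < ε → ∃ λ N → ∀ n → N ℕ.≤ n → ∣ x n - y n ∣ℚ < ε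

  record ℝ : Set where
    constructor mkℝ
    field
      seq    : ℕ → ℚ
      cauchy : IsCauchy seq
  open ℝ public

  infix 4 _≈ℝ_
  _≈ℝ_ : ℝ → ℝ → Set
  x ≈ℝ y = Close (seq x) (seq y)

  open ℚ-Solver.+-*-Solver using (solve; _:+_; _:*_; _:-_; :-_; _:=_)

  private abstract
    half>0 : ∀ {ε} → 0ℚ < ε → 0ℚ < ½ * ε
    half>0 {ε} p = subst (_< ½ * ε) (ℚ.*-zeroʳ ½) (ℚ.*-monoʳ-<-pos ½ p)

    ½+½≡1 : ½ + ½ ≡ 1ℚ
    ½+½≡1 = refl

    half+half : ∀ ε → ½ * ε + ½ * ε ≡ ε
    half+half ε = trans (sym (ℚ.*-distribʳ-+ ε ½ ½)) (trans (cong (_* ε) ½+½≡1) (ℚ.*-identityˡ ε))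


    abs-self : ∀ a {ε} → 0ℚ < ε → ∣ a - a ∣ℚ < ε
    abs-self a {ε} p = subst (λ u → ∣ u ∣ℚ < ε) (sym (ℚ.+-inverseʳ a)) p

    abs-sym : ∀ a b {ε} → ∣ a - b ∣ℚ < ε → ∣ b - a ∣ℚ < ε
    abs-sym a b {ε} p = subst (_< ε)
      (trans (sym (ℚ.∣-p∣≡∣p∣ (a - b)))
             (cong ∣_∣ℚ (solve 2 (λ a b → :- (a :- b) := b :- a) refl a b))) p

    abs-sum : ∀ a b {c δ ε} → c ≡ a + b → ∣ a ∣ℚ < δ → ∣ b ∣ℚ < ε → ∣ c ∣ℚ < δ + ε
    abs-sum a b refl p q = ℚ.≤-<-trans (ℚ.∣p+q∣≤∣p∣+∣q∣ a b) (ℚ.+-mono-< p q)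

    abs-sum½ : ∀ a b {c ε} → c ≡ a + b → ∣ a ∣ℚ < ½ * ε → ∣ b ∣ℚ < ½ * ε → ∣ c ∣ℚ < ε
    abs-sum½ a b {c} {ε} e p q = subst (∣ c ∣ℚ <_) (half+half ε) (abs-sum a b e p q)

    abs-tri : ∀ a b c {ε} → ∣ a - b ∣ℚ < ½ * ε → ∣ b - c ∣ℚ < ½ * ε → ∣ a - c ∣ℚ < ε
    abs-tri a b c = abs-sum½ (a - b) (b - c)
      (solve 3 (λ a b c → a :- c := (a :- b) :+ (b :- c)) refl a b c)

    abs-add : ∀ a a′ b b′ {ε} → ∣ a - a′ ∣ℚ < ½ * ε → ∣ b - b′ ∣ℚ < ½ * ε →
              ∣ (a + b) - (a′ + b′) ∣ℚ < ε
    abs-add a a′ b b′ = abs-sum½ (a - a′) (b - b′)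
      (solve 4 (λ a a′ b b′ → (a :+ b) :- (a′ :+ b′) := (a :- a′) :+ (b :- b′)) refl a a′ b b′)

    abs-neg : ∀ a b {ε} → ∣ a - b ∣ℚ < ε → ∣ (- a) - (- b) ∣ℚ < ε
    abs-neg a b {ε} p = subst (λ u → ∣ u ∣ℚ < ε)
      (solve 2 (λ a b → b :- a := (:- a) :- (:- b)) refl a b) (abs-sym a b p)

    abs-prod : ∀ a b {M δ} → 0ℚ < M → ∣ a ∣ℚ < M → ∣ b ∣ℚ < δ → ∣ a * b ∣ℚ < M * δ
    abs-prod a b {M} {δ} M>0 p q = subst (_< M * δ) (sym (ℚ.∣p*q∣≡∣p∣*∣q∣ a b))
      (ℚ.≤-<-trans
        (ℚ.*-monoʳ-≤-nonNeg ∣ b ∣ℚ {{ℚ.∣-∣-nonNeg b}} (ℚ.<⇒≤ p))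
        (ℚ.*-monoʳ-<-pos M {{ℚ.positive M>0}} q))

    record Small (M ε : ℚ) : Set where
      field
        δ   : ℚ
        δ>0 : 0ℚ < δ
        Mδ  : M * δ ≡ ½ * ε

    small : ∀ M ε → 0ℚ < M → 0ℚ < ε → Small M ε
    small M ε M>0 ε>0 = record
      { δ   = i * (½ * ε)
      ; δ>0 = subst (_< i * (½ * ε)) (ℚ.*-zeroʳ i)
                (ℚ.*-monoʳ-<-pos i {{ℚ.1/pos⇒pos M}} (half>0 ε>0))
      ; Mδ  = trans (sym (ℚ.*-assoc M i (½ * ε)))
                (trans (cong (_* (½ * ε)) (ℚ.*-inverseʳ M)) (ℚ.*-identityˡ (½ * ε)))
      }
      where
      instance
        M-pos : ℚ.Positive M
        M-pos = ℚ.positive M>0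
        M-nz : ℚ.NonZero M
        M-nz = ℚ.pos⇒nonZero M
      i : ℚ
      i = ℚ.1/ M

    abs-mul : ∀ a a′ b b′ {M ε} (s : Small M ε) → 0ℚ < M → ∣ a ∣ℚ < M → ∣ b′ ∣ℚ < M →
              ∣ a - a′ ∣ℚ < Small.δ s → ∣ b - b′ ∣ℚ < Small.δ s →
              ∣ (a * b) - (a′ * b′) ∣ℚ < ε
    abs-mul a a′ b b′ {M} {ε} s M>0 a< b′< da db =
      abs-sum½ (a * (b - b′)) (b′ * (a - a′))
        (solve 4 (λ a a′ b b′ → (a :* b) :- (a′ :* b′) := (a :* (b :- b′)) :+ (b′ :* (a :- a′)))
          refl a a′ b b′)
        (subst (∣ a * (b - b′) ∣ℚ <_) (Small.Mδ s) (abs-prod a (b - b′) M>0 a< db))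
        (subst (∣ b′ * (a - a′) ∣ℚ <_) (Small.Mδ s) (abs-prod b′ (a - a′) M>0 b′< da))

    0<1 : 0ℚ < 1ℚ
    0<1 = ℚ.positive⁻¹ 1ℚ

    near-bound : ∀ a b {δ} → ∣ a - b ∣ℚ < δ → ∣ a ∣ℚ < δ + ∣ b ∣ℚ
    near-bound a b {δ} p = ℚ.≤-<-trans
      (subst (ℚ._≤ ∣ a - b ∣ℚ + ∣ b ∣ℚ)
        (cong ∣_∣ℚ (solve 2 (λ a b → (a :- b) :+ b := a) refl a b))
        (ℚ.∣p+q∣≤∣p∣+∣q∣ (a - b) b))
      (ℚ.+-monoˡ-< ∣ b ∣ℚ p)

    pos-sum : ∀ {δ} w → 0ℚ < δ → 0ℚ < δ + ∣ w ∣ℚ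
    pos-sum {δ} w p = subst (_< δ + ∣ w ∣ℚ) (ℚ.+-identityˡ 0ℚ) (ℚ.+-mono-<-≤ p (ℚ.0≤∣p∣ w))

    pos-sum′ : ∀ {a b} → 0ℚ < a → 0ℚ < b → 0ℚ < a + b
    pos-sum′ {a} {b} p q = subst (_< a + b) (ℚ.+-identityˡ 0ℚ) (ℚ.+-mono-< p q)

    below-sumˡ : ∀ {z} a b → 0ℚ < b → z < a → z < a + b
    below-sumˡ {z} a b p q = subst (_< a + b) (ℚ.+-identityʳ z) (ℚ.+-mono-< q p)

    below-sumʳ : ∀ {z} a b → 0ℚ < a → z < b → z < a + b
    below-sumʳ {z} a b p q = subst (_< a + b) (ℚ.+-identityˡ z) (ℚ.+-mono-< p q)

    -- A common eventual bound for two Cauchy sequences.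
    bound : ∀ x y → IsCauchy x → IsCauchy y →
            ∃ λ M → 0ℚ < M × ∃ λ N → ∀ n → N ℕ.≤ n → ∣ x n ∣ℚ < M × ∣ y n ∣ℚ < M
    bound x y cx cy = go 1ℚ 0<1 (cx 1ℚ 0<1) (cy 1ℚ 0<1)
      where
      go : ∀ δ → 0ℚ < δ →
           (∃ λ N → ∀ m n → N ℕ.≤ m → N ℕ.≤ n → ∣ x m - x n ∣ℚ < δ) →
           (∃ λ N → ∀ m n → N ℕ.≤ m → N ℕ.≤ n → ∣ y m - y n ∣ℚ < δ) →
           ∃ λ M → 0ℚ < M × ∃ λ N → ∀ n → N ℕ.≤ n → ∣ x n ∣ℚ < M × ∣ y n ∣ℚ < M
      go δ δ>0 (N₁ , h₁) (N₂ , h₂) =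
          A + B , pos-sum′ A>0 B>0 , N₁ ℕ.⊔ N₂ , λ n r →
          below-sumˡ A B B>0
            (near-bound (x n) (x N₁) (h₁ n N₁ (ℕ.≤-trans (ℕ.m≤m⊔n N₁ N₂) r) ℕ.≤-refl))
        , below-sumʳ A B A>0
            (near-bound (y n) (y N₂) (h₂ n N₂ (ℕ.≤-trans (ℕ.m≤n⊔m N₁ N₂) r) ℕ.≤-refl))
        where
        A : ℚ
        A = δ + ∣ x N₁ ∣ℚ
        B : ℚ
        B = δ + ∣ y N₂ ∣ℚ
        A>0 : 0ℚ < δ + ∣ x N₁ ∣ℚ
        A>0 = pos-sum (x N₁) δ>0
        B>0 : 0ℚ < δ + ∣ y N₂ ∣ℚ
        B>0 = pos-sum (y N₂) δ>0

    ⊔ˡ : ∀ {a b n} → a ℕ.⊔ b ℕ.≤ n → a ℕ.≤ n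
    ⊔ˡ {a} {b} = ℕ.≤-trans (ℕ.m≤m⊔n a b)

    ⊔ʳ : ∀ {a b n} → a ℕ.⊔ b ℕ.≤ n → b ℕ.≤ n
    ⊔ʳ {a} {b} = ℕ.≤-trans (ℕ.m≤n⊔m a b)

  infixl 6 _+ℝ_
  infixl 7 _*ℝ_
  infix  8 -ℝ_

  fromℚ : ℚ → ℝ
  fromℚ q = mkℝ (λ _ → q) λ ε ε>0 → 0 , λ _ _ _ _ → abs-self q ε>0

  _+ℝ_ : ℝ → ℝ → ℝ
  seq (x +ℝ y) n = seq x n + seq y n
  cauchy (x +ℝ y) ε ε>0 with cauchy x (½ * ε) (half>0 ε>0) | cauchy y (½ * ε) (half>0 ε>0)
  ... | N₁ , h₁ | N₂ , h₂ = N₁ ℕ.⊔ N₂ , λ m n p q →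
    abs-add (seq x m) (seq x n) (seq y m) (seq y n)
      (h₁ m n (⊔ˡ p) (⊔ˡ q)) (h₂ m n (⊔ʳ {N₁} p) (⊔ʳ {N₁} q))

  -ℝ_ : ℝ → ℝ
  seq (-ℝ x) n = - seq x n
  cauchy (-ℝ x) ε ε>0 with cauchy x ε ε>0
  ... | N , h = N , λ m n p q → abs-neg (seq x m) (seq x n) (h m n p q)

  private abstract
    mul-cauchy : ∀ x y → IsCauchy x → IsCauchy y → IsCauchy (λ n → x n * y n)
    mul-cauchy x y cx cy ε ε>0 = go (bound x y cx cy)
      where
      go : (∃ λ M → 0ℚ < M × ∃ λ N → ∀ n → N ℕ.≤ n → ∣ x n ∣ℚ < M × ∣ y n ∣ℚ < M) → (∃ λ N → ∀ m n → N ℕ.≤ m → N ℕ.≤ n → ∣ x m * y m - x n * y n ∣ℚ < ε)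
      go (M , M>0 , N₀ , b) = go′ (cx δ δ>0) (cy δ δ>0)
        where
        s : Small M ε
        s = small M ε M>0 ε>0
        open Small s using (δ; δ>0)
        go′ : (∃ λ N → ∀ m n → N ℕ.≤ m → N ℕ.≤ n → ∣ x m - x n ∣ℚ < δ) →
              (∃ λ N → ∀ m n → N ℕ.≤ m → N ℕ.≤ n → ∣ y m - y n ∣ℚ < δ) → (∃ λ N → ∀ m n → N ℕ.≤ m → N ℕ.≤ n → ∣ x m * y m - x n * y n ∣ℚ < ε)
        go′ (N₁ , h₁) (N₂ , h₂) = N₀ ℕ.⊔ (N₁ ℕ.⊔ N₂) , λ m n p q →
          abs-mul (x m) (x n) (y m) (y n) s M>0
            (proj₁ (b m (⊔ˡ p))) (proj₂ (b n (⊔ˡ q)))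
            (h₁ m n (⊔ˡ (⊔ʳ {N₀} p)) (⊔ˡ (⊔ʳ {N₀} q)))
            (h₂ m n (⊔ʳ {N₁} (⊔ʳ {N₀} p)) (⊔ʳ {N₁} (⊔ʳ {N₀} q)))

    mul-close : ∀ x x′ y y′ → IsCauchy x → IsCauchy y′ → Close x x′ → Close y y′ →
                Close (λ n → x n * y n) (λ n → x′ n * y′ n)
    mul-close x x′ y y′ cx cy′ p q ε ε>0 = go (bound x y′ cx cy′)
      where
      go : (∃ λ M → 0ℚ < M × ∃ λ N → ∀ n → N ℕ.≤ n → ∣ x n ∣ℚ < M × ∣ y′ n ∣ℚ < M) → (∃ λ N → ∀ n → N ℕ.≤ n → ∣ x n * y n - x′ n * y′ n ∣ℚ < ε)
      go (M , M>0 , N₀ , b) = go′ (p δ δ>0) (q δ δ>0)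
        where
        s : Small M ε
        s = small M ε M>0 ε>0
        open Small s using (δ; δ>0)
        go′ : (∃ λ N → ∀ n → N ℕ.≤ n → ∣ x n - x′ n ∣ℚ < δ) →
              (∃ λ N → ∀ n → N ℕ.≤ n → ∣ y n - y′ n ∣ℚ < δ) → (∃ λ N → ∀ n → N ℕ.≤ n → ∣ x n * y n - x′ n * y′ n ∣ℚ < ε)
        go′ (N₁ , h₁) (N₂ , h₂) = N₀ ℕ.⊔ (N₁ ℕ.⊔ N₂) , λ n r →
          abs-mul (x n) (x′ n) (y n) (y′ n) s M>0
            (proj₁ (b n (⊔ˡ r))) (proj₂ (b n (⊔ˡ r)))
            (h₁ n (⊔ˡ (⊔ʳ {N₀} r))) (h₂ n (⊔ʳ {N₁} (⊔ʳ {N₀} r)))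

  _*ℝ_ : ℝ → ℝ → ℝ
  seq (x *ℝ y) n = seq x n * seq y n
  cauchy (x *ℝ y) = mul-cauchy (seq x) (seq y) (cauchy x) (cauchy y)

  private
    pointwise : ∀ {x y} → (∀ n → seq x n ≡ seq y n) → x ≈ℝ y
    pointwise {x} {y} e ε ε>0 = 0 , λ n _ →
      subst (λ u → ∣ seq x n - u ∣ℚ < ε) (e n) (abs-self (seq x n) ε>0)

    ≈-sym : ∀ {x y} → x ≈ℝ y → y ≈ℝ x
    ≈-sym {x} {y} p ε ε>0 with p ε ε>0
    ... | N , h = N , λ n q → abs-sym (seq x n) (seq y n) (h n q)

    ≈-trans : ∀ {x y z} → x ≈ℝ y → y ≈ℝ z → x ≈ℝ z
    ≈-trans {x} {y} {z} p q ε ε>0 with p (½ * ε) (half>0 ε>0) | q (½ * ε) (half>0 ε>0)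
    ... | N₁ , h₁ | N₂ , h₂ = N₁ ℕ.⊔ N₂ , λ n r →
      abs-tri (seq x n) (seq y n) (seq z n) (h₁ n (⊔ˡ r)) (h₂ n (⊔ʳ {N₁} r))

    +-cong : ∀ {x x′ y y′} → x ≈ℝ x′ → y ≈ℝ y′ → x +ℝ y ≈ℝ x′ +ℝ y′
    +-cong {x} {x′} {y} {y′} p q ε ε>0 with p (½ * ε) (half>0 ε>0) | q (½ * ε) (half>0 ε>0)
    ... | N₁ , h₁ | N₂ , h₂ = N₁ ℕ.⊔ N₂ , λ n r →
      abs-add (seq x n) (seq x′ n) (seq y n) (seq y′ n) (h₁ n (⊔ˡ r)) (h₂ n (⊔ʳ {N₁} r))

    -‿cong : ∀ {x y} → x ≈ℝ y → -ℝ x ≈ℝ -ℝ y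
    -‿cong {x} {y} p ε ε>0 with p ε ε>0
    ... | N , h = N , λ n q → abs-neg (seq x n) (seq y n) (h n q)

    *-cong : ∀ {x x′ y y′} → x ≈ℝ x′ → y ≈ℝ y′ → x *ℝ y ≈ℝ x′ *ℝ y′
    *-cong {x} {x′} {y} {y′} = mul-close (seq x) (seq x′) (seq y) (seq y′) (cauchy x) (cauchy y′)

    isCommutativeRing : IsCommutativeRing _≈ℝ_ _+ℝ_ _*ℝ_ -ℝ_ (fromℚ 0ℚ) (fromℚ 1ℚ)
    isCommutativeRing = record
      { isRing = record
        { +-isAbelianGroup = record
          { isGroup = record
            { isMonoid = record
              { isSemigroup = record
                { isMagma = record
                  { isEquivalence = record
                    { refl  = λ {x} → pointwise {x} {x} λ _ → refl
                    ; sym   = λ {x} {y} → ≈-sym {x} {y}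
                    ; trans = λ {x} {y} {z} → ≈-trans {x} {y} {z}
                    }
                  ; ∙-cong = λ {x} {x′} {y} {y′} → +-cong {x} {x′} {y} {y′}
                  }
                ; assoc = λ x y z → pointwise {(x +ℝ y) +ℝ z} {x +ℝ (y +ℝ z)}
                            λ n → ℚ.+-assoc (seq x n) (seq y n) (seq z n)
                }
              ; identity = (λ x → pointwise {fromℚ 0ℚ +ℝ x} {x} λ n → ℚ.+-identityˡ (seq x n))
                         , (λ x → pointwise {x +ℝ fromℚ 0ℚ} {x} λ n → ℚ.+-identityʳ (seq x n))
              }
            ; inverse = (λ x → pointwise { -ℝ x +ℝ x} {fromℚ 0ℚ} λ n → ℚ.+-inverseˡ (seq x n))
                      , (λ x → pointwise {x +ℝ -ℝ x} {fromℚ 0ℚ} λ n → ℚ.+-inverseʳ (seq x n))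
            ; ⁻¹-cong = λ {x} {y} → -‿cong {x} {y}
            }
          ; comm = λ x y → pointwise {x +ℝ y} {y +ℝ x} λ n → ℚ.+-comm (seq x n) (seq y n)
          }
        ; *-cong = λ {x} {x′} {y} {y′} → *-cong {x} {x′} {y} {y′}
        ; *-assoc = λ x y z → pointwise {(x *ℝ y) *ℝ z} {x *ℝ (y *ℝ z)}
                      λ n → ℚ.*-assoc (seq x n) (seq y n) (seq z n)
        ; *-identity = (λ x → pointwise {fromℚ 1ℚ *ℝ x} {x} λ n → ℚ.*-identityˡ (seq x n))
                     , (λ x → pointwise {x *ℝ fromℚ 1ℚ} {x} λ n → ℚ.*-identityʳ (seq x n))
        ; distrib = (λ x y z → pointwise {x *ℝ (y +ℝ z)} {(x *ℝ y) +ℝ (x *ℝ z)}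
                       λ n → ℚ.*-distribˡ-+ (seq x n) (seq y n) (seq z n))
                  , (λ x y z → pointwise {(y +ℝ z) *ℝ x} {(y *ℝ x) +ℝ (z *ℝ x)}
                       λ n → ℚ.*-distribʳ-+ (seq x n) (seq y n) (seq z n))
        }
      ; *-comm = λ x y → pointwise {x *ℝ y} {y *ℝ x} λ n → ℚ.*-comm (seq x n) (seq y n)
      }

  ℝ-ring : CommutativeRing 0ℓ 0ℓ
  ℝ-ring = record { isCommutativeRing = isCommutativeRing }

open Real public using (ℝ; ℝ-ring)

module LinearAlgebra {c ℓ : Level} (K : CommutativeRing c ℓ) where

  open CommutativeRing K hiding (refl; sym; trans; zero)
  module K = CommutativeRing K
  open import Algebra.Properties.CommutativeMonoid.Sum +-commutativeMonoid
    using (sum-remove; sum-cong-≋; sum-replicate-zero) renaming (sum to ∑ᵥ)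
  open import Algebra.Properties.Group +-group using (x∙y⁻¹≈ε⇒x≈y; x≈y⇒x∙y⁻¹≈ε)

  lincomb : ∀ {n d} → Vector Carrier d → Vector (Vector Carrier n) d → Vector Carrier n
  lincomb c b i = ∑ᵥ λ k → c k * b k i

  record IsBasis {n d} (W : Pred (Vector Carrier n) ℓ) (b : Vector (Vector Carrier n) d) :
                 Set (c ⊔ ℓ) where
    field
      independent : ∀ c → (∀ i → lincomb c b i ≈ 0#) → ∀ k → c k ≈ 0#
      spanning    : ∀ x → W x ⇔ (∃ λ c → ∀ i → x i ≈ lincomb c b i)

  HasDimension : ∀ {n} → Pred (Vector Carrier n) ℓ → ℕ → Set (c ⊔ ℓ)
  HasDimension {n} W d = Σ (Vector (Vector Carrier n) d) (IsBasis W)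

  ⋂ : ∀ {n m} → (Fin m → Pred (Vector Carrier n) ℓ) → Subset m → Pred (Vector Carrier n) ℓ
  ⋂ H B x = ∀ k → k ∈ B → H k x

  diagonal : ∀ {n} → Fin n × Fin n → Pred (Vector Carrier n) ℓ
  diagonal (i , j) x = x i - x j ≈ 0#

  -- An intersection of diagonals is the space of vectors constant on the
  -- fibres of a labelling Fin n → Fin d; the indicator vectors of the
  -- fibres form a basis.

  record Labelling {n} (W : Pred (Vector Carrier n) ℓ) : Set (c ⊔ ℓ) where
    field
      d        : ℕ
      label    : Fin n → Fin d
      repr     : Fin d → Fin n
      label-repr : ∀ k → label (repr k) ≡ k
      to       : ∀ x → W x → ∀ i j → label i ≡ label j → x i ≈ x j
      from     : ∀ x → (∀ i j → label i ≡ label j → x i ≈ x j) → W x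

  δ : ∀ {d} → Fin d → Fin d → Carrier
  δ a k with a ≟ k
  ... | yes _ = 1#
  ... | no  _ = 0#

  δ-same : ∀ {d} (a : Fin d) → δ a a ≈ 1#
  δ-same a with a ≟ a
  ... | yes _ = K.refl
  ... | no  p = contradiction refl p

  δ-diff : ∀ {d} (a k : Fin d) → a ≢ k → δ a k ≈ 0#
  δ-diff a k a≢k with a ≟ k
  ... | yes p = contradiction p a≢k
  ... | no  _ = K.refl

  ∑-δ : ∀ {d} (c : Vector Carrier d) a → ∑ᵥ (λ k → c k * δ a k) ≈ c a
  ∑-δ {suc d} c a = K.trans (sum-remove {i = a} (λ k → c k * δ a k))
    (K.trans (+-cong (K.trans (*-congˡ (δ-same a)) (*-identityʳ (c a)))
                     (K.trans (sum-cong-≋ λ k → K.trans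
                                 (*-congˡ (δ-diff a (punchIn a k) (punchInᵢ≢i a k ∘ sym)))
                                 (zeroʳ (c (punchIn a k))))
                              (sum-replicate-zero d)))
             (+-identityʳ (c a)))

  labelling⇒dimension : ∀ {n} {W : Pred (Vector Carrier n) ℓ} (L : Labelling W) →
                        HasDimension W (Labelling.d L)
  labelling⇒dimension L = (λ k i → δ (label i) k) , record
    { independent = λ c c≈0 k → K.trans
        (K.reflexive (cong c (sym (label-repr k))))
        (K.trans (K.sym (∑-δ c (label (repr k)))) (c≈0 (repr k)))
    ; spanning = λ x → mk⇔
        (λ w → x ∘ repr , λ i → K.trans
          (to x w i (repr (label i)) (sym (label-repr (label i))))
          (K.sym (∑-δ (x ∘ repr) (label i))))
        (λ { (c , e) → from x λ i j p → K.trans (e i)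
          (K.trans (∑-δ c (label i))
            (K.trans (K.reflexive (cong c p))
              (K.trans (K.sym (∑-δ c (label j))) (K.sym (e j))))) })
    }
    where open Labelling L

  discrete : ∀ {n} (W : Pred (Vector Carrier n) ℓ) → (∀ x → W x) → Labelling W
  discrete {n} W all = record
    { d = n ; label = id ; repr = id ; label-repr = λ _ → refl
    ; to = λ x _ i j p → K.reflexive (cong x p)
    ; from = λ x _ → all x
    }

  resp : ∀ {n} {V W : Pred (Vector Carrier n) ℓ} → (∀ x → V x → W x) → (∀ x → W x → V x) →
         Labelling V → Labelling W
  resp f g L = record
    { d = d ; label = label ; repr = repr ; label-repr = label-repr
    ; to = λ x w → to x (g x w)
    ; from = λ x h → f x (from x h)
    }
    where open Labelling L

  -- Rename label b to a, then close the gap.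
  redirect : ∀ {d} (a b : Fin (suc d)) → b ≢ a → Fin (suc d) → Fin d
  redirect a b b≢a k with b ≟ k
  ... | yes _   = punchOut b≢a
  ... | no  b≢k = punchOut b≢k

  redirect-punchIn : ∀ {d} (a b : Fin (suc d)) b≢a m → redirect a b b≢a (punchIn b m) ≡ m
  redirect-punchIn a b b≢a m with b ≟ punchIn b m
  ... | yes p   = contradiction (sym p) (punchInᵢ≢i b m)
  ... | no  _   = trans (Fin.punchOut-cong b refl) (punchOut-punchIn b)

  redirect-merges : ∀ {d} (a b : Fin (suc d)) b≢a → redirect a b b≢a a ≡ redirect a b b≢a b
  redirect-merges a b b≢a with b ≟ a | b ≟ b
  ... | yes p | _     = contradiction p b≢a
  ... | no _  | yes _ = Fin.punchOut-cong b refl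
  ... | no _  | no q  = contradiction refl q

  redirect-only : ∀ {d} (a b : Fin (suc d)) b≢a k l → redirect a b b≢a k ≡ redirect a b b≢a l →
                  k ≡ l ⊎ ((k ≡ b × l ≡ a) ⊎ (k ≡ a × l ≡ b))
  redirect-only a b b≢a k l e with b ≟ k | b ≟ l
  ... | yes refl | yes refl = inj₁ refl
  ... | yes refl | no  b≢l  = inj₂ (inj₁ (refl , sym (Fin.punchOut-injective b≢a b≢l e)))
  ... | no  b≢k  | yes refl = inj₂ (inj₂ (Fin.punchOut-injective b≢k b≢a e , refl))
  ... | no  b≢k  | no  b≢l  = inj₁ (Fin.punchOut-injective b≢k b≢l e)

  module Merge {n d} (label : Fin n → Fin (suc d)) (repr : Fin (suc d) → Fin n)
               (label-repr : ∀ k → label (repr k) ≡ k)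
               (W : Pred (Vector Carrier n) ℓ)
               (to : ∀ x → W x → ∀ i j → label i ≡ label j → x i ≈ x j)
               (from : ∀ x → (∀ i j → label i ≡ label j → x i ≈ x j) → W x)
               (i j : Fin n) (j≢i : label j ≢ label i) where

    new : Fin n → Fin d
    new u = redirect (label i) (label j) j≢i (label u)

    merged : Labelling (λ x → diagonal (i , j) x × W x)
    merged = record
      { d = d
      ; label = new
      ; repr = λ k → repr (punchIn (label j) k)
      ; label-repr = λ k → trans
          (cong (redirect (label i) (label j) j≢i) (label-repr (punchIn (label j) k)))
          (redirect-punchIn (label i) (label j) j≢i k)
      ; to = λ { x (xi-xj , w) u v e →
          case redirect-only (label i) (label j) j≢i (label u) (label v) e of λ
            { (inj₁ p) → to x w u v p
            ; (inj₂ (inj₁ (p , q))) → K.trans (to x w u j p)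
                (K.trans (K.sym (x∙y⁻¹≈ε⇒x≈y (x i) (x j) xi-xj)) (to x w i v (sym q)))
            ; (inj₂ (inj₂ (p , q))) → K.trans (to x w u i p)
                (K.trans (x∙y⁻¹≈ε⇒x≈y (x i) (x j) xi-xj) (to x w j v (sym q)))
            } }
      ; from = λ x h →
            x≈y⇒x∙y⁻¹≈ε (h i j (redirect-merges (label i) (label j) j≢i))
          , from x λ u v p → h u v (cong (redirect (label i) (label j) j≢i) p)
      }

  merge : ∀ {n} {W : Pred (Vector Carrier n) ℓ} i j → Labelling W →
          Labelling (λ x → diagonal (i , j) x × W x)
  merge {n} {W} i j L = go (Labelling.d L) (Labelling.label L) (Labelling.repr L)
                       (Labelling.label-repr L) (Labelling.to L) (Labelling.from L)
    where
    go : ∀ d (label : Fin n → Fin d) (repr : Fin d → Fin n) →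
         (∀ k → label (repr k) ≡ k) →
         (∀ x → W x → ∀ i j → label i ≡ label j → x i ≈ x j) →
         (∀ x → (∀ i j → label i ≡ label j → x i ≈ x j) → W x) →
         Labelling (λ x → diagonal (i , j) x × W x)
    go zero label _ _ _ _ = case label i of λ ()
    go (suc d) label repr label-repr to from with label j ≟ label i
    ... | yes p  = record
      { d = suc d ; label = label ; repr = repr ; label-repr = label-repr
      ; to = λ { x (_ , w) → to x w }
      ; from = λ x h → x≈y⇒x∙y⁻¹≈ε (h i j (sym p)) , from x h
      }
    ... | no j≢i = Merge.merged label repr label-repr W to from i j j≢i

  labelling : ∀ {n m} (e : Fin m → Fin n × Fin n) (B : Subset m) →
              Labelling (⋂ (diagonal ∘ e) B)
  labelling e []            = discrete (⋂ (diagonal ∘ e) []) λ _ ()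
  labelling e (outside ∷ B) = resp
    (λ { x h (suc k) (Vec.there k∈B) → h k k∈B })
    (λ x h k k∈B → h (suc k) (Vec.there k∈B))
    (labelling (e ∘ suc) B)
  labelling e (inside ∷ B)  = resp
    (λ { x (h₀ , h) zero    Vec.here        → h₀
       ; x (h₀ , h) (suc k) (Vec.there k∈B) → h k k∈B })
    (λ x h → h zero Vec.here , λ k k∈B → h (suc k) (Vec.there k∈B))
    (merge (proj₁ (e zero)) (proj₂ (e zero)) (labelling (e ∘ suc) B))

  dim-⋂-diagonals : ∀ {n m} (e : Fin m → Fin n × Fin n) (B : Subset m) →
                    ∃ (HasDimension (⋂ (diagonal ∘ e) B))
  dim-⋂-diagonals e B = Labelling.d (labelling e B) , labelling⇒dimension (labelling e B)

module ℝ-LinearAlgebra = LinearAlgebra ℝ-ring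
open ℝ-LinearAlgebra using (HasDimension; ⋂; diagonal; dim-⋂-diagonals)

-- Constructively, not every subspace of ℝⁿ has a dimension, so the
-- dimensions of the intersections are part of the data, each certified by
-- a basis.
record Arrangement (n : ℕ) : Set₁ where
  field
    size       : ℕ
    hyperplane : Fin size → Pred (Vector ℝ n) 0ℓ
    dim        : ∀ B → ∃ (HasDimension (⋂ hyperplane B))

  rank : Subset size → ℕ
  rank B = n ∸ proj₁ (dim B)

  full : Subset size
  full = ⊤

allSubsets : ∀ m → List (Subset m)
allSubsets zero    = [] ∷ []
allSubsets (suc m) = map (outside ∷_) (allSubsets m) ++ map (inside ∷_) (allSubsets m)

-- root i j _ stands for the positive root e_i - e_j of type A_{n-1}.

record Root (n : ℕ) : Set where
  constructor root
  field
    lo hi : Fin n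
    lo<hi : lo Fin.< hi
open Root public

infix 4 _≼_
_≼_ : ∀ {n} → Root n → Root n → Set
α ≼ β = lo β Fin.≤ lo α × hi α Fin.≤ hi β

Simple : ∀ {n} → Pred (Root n) 0ℓ
Simple α = toℕ (hi α) ≡ suc (toℕ (lo α))

rootsAt : ∀ {n} → Fin n → Fin n → List (Root n)
rootsAt i j with i <? j
... | yes i<j = root i j i<j ∷ []
... | no  _   = []

allRoots : ∀ n → List (Root n)
allRoots n = concatMap (λ i → concatMap (rootsAt i) (allFin n)) (allFin n)

∈-allRoots : ∀ {n} (α : Root n) → α List.∈ allRoots n
∈-allRoots {n} (root i j i<j) =
  ∈-concatMap⁺ (λ i → concatMap (rootsAt i) (allFin n))
    (List.lose (∈-allFin i) (∈-concatMap⁺ (rootsAt i) (List.lose (∈-allFin j) here-root)))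
  where
  here-root : root i j i<j List.∈ rootsAt i j
  here-root with i <? j
  ... | yes p = here (cong (root i j) (ℕ.<-irrelevant i<j p))
  ... | no  p = contradiction i<j p

-- Membership is decidable, as for every subset of a finite set classically.
record Ideal (n : ℕ) : Set₁ where
  field
    mem      : Pred (Root n) 0ℓ
    mem?     : Decidable mem
    upClosed : ∀ {α β} → α ≼ β → mem α → mem β
open Ideal public

Full : ∀ {n} → Ideal n → Set
Full I = ∀ α → Simple α → ¬ mem I α

complement : ∀ {n} → Ideal n → List (Root n)
complement {n} I = filter (λ α → ¬? (mem? I α)) (allRoots n)

-- Distinct roots have distinct hyperplanes and complement I has no
-- repetitions, so subsets of the index set are subarrangements.
𝒜 : ∀ {n} → Ideal n → Arrangement n
𝒜 I = record
  { size       = length (complement I)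
  ; hyperplane = diagonal ∘ ends
  ; dim        = dim-⋂-diagonals ends
  }
  where
  ends : Fin (length (complement I)) → Fin _ × Fin _
  ends k = lo (List.lookup (complement I) k) , hi (List.lookup (complement I) k)

Maximal : ∀ {n} → Ideal n → Pred (Root n) 0ℓ
Maximal I α = ¬ mem I α × (∀ β → ¬ mem I β → α ≼ β → β ≡ α)

_≟-root_ : ∀ {n} (α β : Root n) → Dec (α ≡ β)
root i j p ≟-root root k l q with i ≟ k | j ≟ l
... | yes refl | yes refl = yes (cong (root i j) (ℕ.<-irrelevant p q))
... | no  i≢k  | _        = no λ { refl → i≢k refl }
... | yes _    | no j≢l   = no λ { refl → j≢l refl }

maximal? : ∀ {n} (I : Ideal n) → Decidable (Maximal I)
maximal? {n} I α = ¬? (mem? I α) ×-dec map′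
  (λ h β → All.lookup h (∈-allRoots β)) (λ h → All.tabulate λ {β} _ → h β)
  (All.all? (λ β → ¬? (mem? I β) →-dec ((lo β ≤? lo α ×-dec hi α ≤? hi β) →-dec (β ≟-root α)))
            (allRoots n))

maximalRoots : ∀ {n} → Ideal n → List (Root n)
maximalRoots {n} I = filter (maximal? I) (allRoots n)

signature : ∀ {n} (I : Ideal n) → Fin n → Subset (length (maximalRoots I))
signature I u = Vec.tabulate λ l →
  let α = List.lookup (maximalRoots I) l in does (lo α ≤? u ×-dec u ≤? hi α)

ConstantOn : ∀ {n} {X : Set} → (Fin n → X) → Subset n → Set
ConstantOn s S = ∀ {a b} → a ∈ S → b ∈ S → s a ≡ s b

IsMaximalConstant : ∀ {n} {X : Set} → (Fin n → X) → Subset n → Set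
IsMaximalConstant s S =
  Nonempty S × ConstantOn s S × (∀ S′ → S ⊆ S′ → ConstantOn s S′ → S′ ⊆ S)

IsMinimum : ∀ {n} → Subset n → Fin n → Set
IsMinimum S a = a ∈ S × (∀ {b} → b ∈ S → a Fin.≤ b)

record PartitionBy {n} {X : Set} (s : Fin n → X) : Set where
  field
    r          : ℕ
    block      : Fin r → Subset n
    min        : Fin r → Fin n
    isMaximal  : ∀ u → IsMaximalConstant s (block u)
    exhaustive : ∀ S → IsMaximalConstant s S → ∃ λ u → block u ≡ S
    isMinimum  : ∀ u → IsMinimum (block u) (min u)
    increasing : ∀ {u v} → u Fin.< v → min u Fin.< min v

Accordance : ∀ {n} → Ideal n → Set
Accordance I = PartitionBy (signature I)

module PartitionConstruction {n} {X : Set} (_≟X_ : (a b : X) → Dec (a ≡ b)) (s : Fin n → X) where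

  Leader : Pred (Fin n) 0ℓ
  Leader u = ∀ v → v Fin.< u → s v ≢ s u

  leader? : Decidable Leader
  leader? u = Fin.all? λ v → (v <? u) →-dec ¬? (s v ≟X s u)

  leaders : List (Fin n)
  leaders = filter leader? (allFin n)

  fibre : Fin n → Subset n
  fibre a = Vec.tabulate λ v → does (s v ≟X s a)

  ∈-fibre⁺ : ∀ {a v} → s v ≡ s a → v ∈ fibre a
  ∈-fibre⁺ {a} {v} p = Vec.lookup⇒[]= v (fibre a)
    (trans (Vec.lookup∘tabulate _ v) (dec-true (s v ≟X s a) p))

  ∈-fibre⁻ : ∀ {a v} → v ∈ fibre a → s v ≡ s a
  ∈-fibre⁻ {a} {v} h with s v ≟X s a in eq
  ... | yes p = p
  ... | no  _ = case trans (sym (Vec.[]=⇒lookup h))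
                  (trans (Vec.lookup∘tabulate _ v) (cong does eq)) of λ ()

  leaderOf : ∀ a → ∃ λ v → s v ≡ s a × Leader v
  leaderOf a = go a (<-wellFounded a)
    where
    go : ∀ a → Acc Fin._<_ a → ∃ λ v → s v ≡ s a × Leader v
    go a (acc rs) with any? (λ v → (v <? a) ×-dec (s v ≟X s a))
    ... | no  none          = a , refl , λ v v<a p → none (v , v<a , p)
    ... | yes (v , v<a , p) with go v (rs v<a)
    ...   | w , q , l = w , trans q p , l

  fibre-maximal : ∀ a → IsMaximalConstant s (fibre a)
  fibre-maximal a = (a , ∈-fibre⁺ refl)
                  , (λ p q → trans (∈-fibre⁻ p) (sym (∈-fibre⁻ q)))
                  , λ S′ ⊆S′ const v∈S′ → ∈-fibre⁺ (const v∈S′ (⊆S′ (∈-fibre⁺ refl)))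

  leader-lookup : ∀ u → Leader (List.lookup leaders u)
  leader-lookup u = proj₂ (∈-filter⁻ leader? {xs = allFin n} (∈-lookup {xs = leaders} u))

  lookup-increasing : ∀ {xs : List (Fin n)} → AllPairs Fin._<_ xs →
                      ∀ {u v} → u Fin.< v → List.lookup xs u Fin.< List.lookup xs v
  lookup-increasing (x<xs ∷ _) {zero}  {suc v} _   = All.lookup x<xs (∈-lookup v)
  lookup-increasing (_ ∷ rest) {suc u} {suc v} u<v = lookup-increasing rest (ℕ.s<s⁻¹ u<v)

  partition : PartitionBy s
  partition = record
    { r          = length leaders
    ; block      = fibre ∘ List.lookup leaders
    ; min        = List.lookup leaders
    ; isMaximal  = fibre-maximal ∘ List.lookup leaders
    ; exhaustive = exhaustive
    ; isMinimum  = λ u → ∈-fibre⁺ refl ,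
                     λ b∈ → ℕ.≮⇒≥ λ b<u → leader-lookup u _ b<u (∈-fibre⁻ b∈)
    ; increasing = lookup-increasing
                     (AllPairs.filter⁺ leader? (AllPairs.tabulate⁺-< id))
    }
    where
    exhaustive : ∀ S → IsMaximalConstant s S →
                 ∃ λ u → fibre (List.lookup leaders u) ≡ S
    exhaustive S ((a , a∈S) , const , max) with leaderOf a
    ... | v , sv≡sa , l with ∈-filter⁺ leader? (∈-allFin v) l
    ...   | v∈ = Any.index v∈ , trans (cong fibre (sym (Any.lookup-index v∈)))
                   (⊆-antisym
                     (max (fibre v) S⊆ λ p q → trans (∈-fibre⁻ p) (sym (∈-fibre⁻ q))) S⊆)
      where
      S⊆ : S ⊆ fibre v
      S⊆ b∈S = ∈-fibre⁺ (trans (const b∈S a∈S) (sym sv≡sa))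

-- The fields of PartitionBy determine the blocks and their order; this
-- shows that such a partition exists.
accordance : ∀ {n} (I : Ideal n) → Accordance I
accordance I = PartitionConstruction.partition (Vec.≡-dec Bool._≟_) (signature I)

module _ {n} (I : Ideal n) (P : Accordance I) where

  open PartitionBy P

  blockSignature : Fin r → Subset (length (maximalRoots I))
  blockSignature u = signature I (min u)

  R : Fin r → List (Fin r)
  R u = filter (λ v → (u <? v) ×-dec nonempty? (blockSignature u ∩ blockSignature v)) (allFin r)

∑ℕ : ∀ {m} → (Fin m → ℕ) → ℕ
∑ℕ f = sum (List.tabulate f)

∏ℕ : ∀ {m} → (Fin m → ℕ) → ℕ
∏ℕ f = product (List.tabulate f)

∏!-nonZero : ∀ {p} (a : Fin p → ℕ) → ℕ.NonZero (∏ℕ λ s → a s !)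
∏!-nonZero {zero}  a = _
∏!-nonZero {suc p} a = ℕ.m*n≢0 (a zero !) (∏ℕ λ s → a (suc s) !)
  {{a zero ℕ.!≢0}} {{∏!-nonZero (a ∘ suc)}}

multinomial : ∀ {p} → ℕ → (Fin p → ℕ) → ℕ
multinomial N a = _/_ (N !) (∏ℕ λ s → a s !) {{∏!-nonZero a}}

choices : ∀ {X : Set} m → (Fin m → List X) → List (Fin m → X)
choices zero    xs = (λ ()) ∷ []
choices (suc m) xs = cartesianProductWith F._∷_ (xs zero) (choices m (xs ∘ suc))

weakCompositions : ∀ p → ℕ → List (Fin p → ℕ)
weakCompositions p N = filter (λ a → ∑ℕ a ℕ.≟ N) (choices p λ _ → upTo (suc N))

families : ∀ {r} p → (Fin r → ℕ) → List (Fin r → Fin p → ℕ)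
families {r} p N = choices r λ u → weakCompositions p (N u)

OddPrime : Pred ℕ 0ℓ
OddPrime p = Prime p × 2 ∤ p

NextPrime : ℕ → Pred ℕ 0ℓ
NextPrime m q = m ℕ.< q × Prime q × (∀ r → m ℕ.< r → r ℕ.< q → ¬ Prime r)

-- Euclid: a prime factor of 1 + m! exceeds m.
primeAbove : ∀ m → ∃ λ q → m ℕ.< q × Prime q
primeAbove m with factorise (suc (m !))
... | record { factors = [] ; isFactorisation = e } =
  contradiction (ℕ.suc-injective e) (ℕ.≢-nonZero⁻¹ (m !) {{m ℕ.!≢0}})
... | record { factors = q ∷ qs ; isFactorisation = e ; factorsPrime = pq All.∷ _ } =
  q , ℕ.≰⇒> q≰m , pq
  where
  q∣1+m! : q ∣ m ! ℕ.+ 1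
  q∣1+m! = subst (q ∣_) (trans (sym e) (ℕ.+-comm 1 (m !))) (m∣m*n (product qs))
  self∣! : ∀ k → .{{ℕ.NonZero k}} → k ∣ k !
  self∣! (suc k) = m∣m*n (k !)
  q≰m : ¬ (q ℕ.≤ m)
  q≰m q≤m = ¬prime[1] (subst Prime (∣1⇒≡1 (∣m+n∣m⇒∣n q∣1+m!
    (∣-trans (self∣! q {{prime⇒nonZero pq}}) (m≤n⇒m!∣n! q≤m)))) pq)

nextPrime : ∀ m → ∃ (NextPrime m)
nextPrime m with primeAbove m
... | q , m<q , pq = search (q ∸ suc m) (suc m) (ℕ.m∸n+n≡m m<q) ℕ.≤-refl
                       λ r m<r r≤m → contradiction m<r (ℕ.<⇒≱ r≤m)
  where
  search : ∀ gap k → gap ℕ.+ k ≡ q → m ℕ.< k → (∀ r → m ℕ.< r → r ℕ.< k → ¬ Prime r) →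
           ∃ (NextPrime m)
  search zero      k refl m<k none = k , m<k , pq , none
  search (suc gap) k e    m<k none with prime? k
  ... | yes pk = k , m<k , pk , none
  ... | no ¬pk = search gap (suc k) (trans (ℕ.+-suc gap k) e) (ℕ.m<n⇒m<1+n m<k)
    λ r m<r r<1+k → case ℕ.m≤n⇒m<n∨m≡n (ℕ.s≤s⁻¹ r<1+k) of λ
      { (inj₁ r<k)  → none r m<r r<k
      ; (inj₂ refl) → ¬pk
      }

-- oddPrime i is the i-th odd prime for i ≥ 1; oddPrime 0 = 2 only starts
-- the recursion.
oddPrime : ℕ → ℕ
oddPrime zero    = 2
oddPrime (suc i) = proj₁ (nextPrime (oddPrime i))

-- The reciprocal of a nonzero integer; the value at 0 is a dummy.
recip : ℤ → ℚ
recip (+ zero)    = 0ℚ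
recip (+ (suc d)) = + 1 ℚ./ suc d
recip -[1+ d ]    = -[1+ 0 ] ℚ./ suc d

-- Polynomials are evaluated in arbitrary commutative ℚ-algebras.  Since
-- ℚ[x, y, 1/(y-1)] is one of them, an identity valid in all of them is an
-- identity of rational functions in x and y.
record ℚAlgebra (c ℓ : Level) : Set (lsuc (c ⊔ ℓ)) where
  field
    commutativeRing : CommutativeRing c ℓ
  open CommutativeRing commutativeRing public
    hiding (refl; sym; trans; zero)
  field
    ι     : ℚ → Carrier
    ι-hom : RingMorphisms.IsRingHomomorphism
              (CommutativeRing.rawRing ℚ.+-*-commutativeRing) rawRing ι

  open import Algebra.Properties.Semiring.Exp semiring public using (_^_)

  ιℕ : ℕ → Carrier
  ιℕ m = ι (+ m ℚ./ 1)

  infixr 6 ∑ ∏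
  ∑ : ∀ {X : Set} → List X → (X → Carrier) → Carrier
  ∑ xs f = foldr (λ a s → f a + s) 0# xs

  ∏ : ∀ {X : Set} → List X → (X → Carrier) → Carrier
  ∏ xs f = foldr (λ a s → f a * s) 1# xs

  syntax ∑ xs (λ a → e) = ∑[ a ∈ xs ] e
  syntax ∏ xs (λ a → e) = ∏[ a ∈ xs ] e

  -- The truncated differences are exact: rank is monotone and rank B ≤ ∣ B ∣.
  tutte : ∀ {n} → Arrangement n → Carrier → Carrier → Carrier
  tutte 𝒞 x y = ∑[ B ∈ allSubsets size ]
      (x - 1#) ^ (rank full ∸ rank B) * (y - 1#) ^ (∣ B ∣ ∸ rank B)
    where open Arrangement 𝒞

  coboundary : ∀ {n} → Arrangement n → Carrier → Carrier → Carrier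
  coboundary 𝒞 q t = ∑[ B ∈ allSubsets size ]
      q ^ (rank full ∸ rank B) * (t - 1#) ^ ∣ B ∣
    where open Arrangement 𝒞

𝐩 : ∀ {n} → Fin n → ℕ
𝐩 i = oddPrime (suc (toℕ i))

others : ∀ {n} → Fin n → List (Fin n)
others {n} i = filter (λ j → ¬? (j ≟ i)) (allFin n)

{-# OPTIONS --safe #-}

-- By the finite field method in its combinatorial form, p^(dim ⋂ B) is the
-- number of colourings Fin n → Fin p that are constant along the edges in B.
-- Expanding the coboundary polynomial and summing over B first turns
-- p · χ̄(p, t) into the sum of t^(number of monochromatic edges) over all
-- colourings.  Two vertices span an edge of I^c iff their signatures meet, so
-- this number depends only on how often each colour occurs in each block, and
-- the colourings with prescribed occurrences are counted by multinomials.
-- The Tutte polynomial is χ̄((x-1)(y-1), y) up to a power of y-1, and χ̄ has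
-- degree < n in q, so it is recovered from n values by Lagrange interpolation.

module Submission where

open import Defs
open import Algebra.Bundles using (CommutativeMonoid; CommutativeSemiring; CommutativeRing)
open import Algebra.Morphism.Structures using (module RingMorphisms)
import Algebra.Solver.Ring as RingSolver
open import Algebra.Solver.Ring.AlmostCommutativeRing using (fromCommutativeRing; _-Raw-AlmostCommutative⟶_)
open import Data.Bool.Base using (true; false; if_then_else_)
import Data.Bool.Properties as Bool
open import Data.Fin.Base as Fin using (Fin; zero; suc; toℕ)
import Data.Fin.Induction as Fin using (<-weakInduction)
import Data.Fin.Properties as Fin
open import Data.Fin.Subset using (Subset; _∈_; _⊆_; _∩_; ∣_∣; ⊤; Nonempty; inside; outside)
open import Data.Fin.Subset.Properties using (_∈?_; ∈⊤; nonempty?; x∈p∩q⁺; x∈p∩q⁻; ∩-comm; ⊆-antisym)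
open import Data.Integer.Base as ℤ using (+_; -[1+_]) renaming (_-_ to _-ℤ_)
import Data.Integer.Properties as ℤ
open import Data.List.Base as List
  using (List; []; _∷_; _++_; map; foldr; filter; concatMap; cartesianProductWith; allFin; upTo; lookup; length; tabulate)
import Data.List.Membership.Propositional as List
open import Data.List.Membership.Propositional.Properties using (∈-filter⁺; ∈-filter⁻; ∈-lookup; ∈-cartesianProductWith⁻)
import Data.List.Properties as List
open import Data.List.Relation.Unary.Any as Any using (here; there)
import Data.List.Relation.Unary.Any.Properties as Any
import Data.Maybe.Base as Maybe
open import Data.Nat.Base as ℕ using (ℕ; zero; suc; _∸_; _!; _≤_; _<_; z≤n; s≤s) renaming (_+_ to _+ℕ_; _*_ to _*ℕ_)
open import Data.Nat.Combinatorics using (_C_; nC1≡n; nCk+nC[k+1]≡[n+1]C[k+1])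
open import Data.Nat.DivMod using (m*n/n≡m; /-congˡ)
open import Data.Nat.ListAction using (sum)
open import Data.Nat.Primality using (prime⇒nonZero)
import Data.Nat.Properties as ℕ
open import Data.Nat.Solver using (module +-*-Solver)
open import Data.Product.Base using (∃; _×_; _,_; proj₁; proj₂; uncurry)
open import Data.Rational.Base as ℚ using (0ℚ; 1ℚ; ½)
import Data.Rational.Properties as ℚ
open import Data.Rational.Unnormalised.Base as ℚᵘ using (mkℚᵘ; *≡*)
import Data.Rational.Unnormalised.Properties as ℚᵘ
open import Data.Sum.Base using (inj₁; inj₂)
open import Data.Vec.Base as Vec using (_∷_; [])
import Data.Vec.Functional as F
import Data.Vec.Properties as Vec
open import Function.Base using (_∘_; id; case_of_)
open import Function.Bundles using (mk⇔)
open import Level using (0ℓ; _⊔_)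
open import Relation.Binary.Definitions using (tri<; tri≈; tri>)
open import Relation.Binary.PropositionalEquality as ≡ using (_≡_; _≢_; cong; cong₂; subst)
import Relation.Binary.Reasoning.Setoid as SetoidReasoning
open import Relation.Nullary using (¬_; Dec; yes; no; does; contradiction)
open import Relation.Nullary.Decidable using (_×-dec_; _→-dec_; ¬?; does-⇔; dec-true; dec-false; decidable-stable; from-no)
open import Relation.Nullary.Decidable.Core using (dec⇒maybe)
open import Relation.Unary using (Pred; Decidable)

-- Sums and products over lists

-- Ranks are defined by dimensions over ℝ, so the passage to colourings by `Fin p` needs a bridge:
-- the labelling that certifies the dimension of an intersection of diagonals already partitions the
-- vertices, and real vectors with entries 0 and 1 suffice to recognise that partition. Fullness
-- makes the whole graph connected, so the corank of `B` is its number of components minus one; the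
-- missing power is the factor p.
--
-- Polynomials occur only as functions on a commutative ℚ-algebra that may have zero divisors, so
-- neither coefficients nor a count of roots is available; divided differences stand in for both.
-- Colourings and families are functions, comparable only pointwise, so sums are not reindexed along
-- bijections: a sum of Iverson brackets with value 1 is inserted and the order of summation
-- exchanged. Identities in ℕ that would call for division or subtraction are proved with
-- denominators cleared or both sides doubled.

module BigOperator {c ℓ} (M : CommutativeMonoid c ℓ) where

  open CommutativeMonoid M
  open SetoidReasoning setoid
  open import Algebra.Properties.CommutativeSemigroup commutativeSemigroup using (interchange)

  ⨁ : {X : Set} → List X → (X → Carrier) → Carrier
  ⨁ xs f = foldr (λ a s → f a ∙ s) ε xs

  ⨁-cong-∈ : ∀ {X : Set} (xs : List X) {f g : X → Carrier} →
             (∀ {x} → x List.∈ xs → f x ≈ g x) → ⨁ xs f ≈ ⨁ xs g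
  ⨁-cong-∈ []       h = refl
  ⨁-cong-∈ (x ∷ xs) h = ∙-cong (h (here ≡.refl)) (⨁-cong-∈ xs (h ∘ there))

  ⨁-cong : ∀ {X : Set} (xs : List X) {f g : X → Carrier} → (∀ x → f x ≈ g x) → ⨁ xs f ≈ ⨁ xs g
  ⨁-cong xs h = ⨁-cong-∈ xs λ {x} _ → h x

  ⨁-ε : ∀ {X : Set} (xs : List X) → ⨁ xs (λ _ → ε) ≈ ε
  ⨁-ε []       = refl
  ⨁-ε (x ∷ xs) = trans (identityˡ _) (⨁-ε xs)

  ⨁-∙ : ∀ {X : Set} (xs : List X) (f g : X → Carrier) → ⨁ xs (λ x → f x ∙ g x) ≈ ⨁ xs f ∙ ⨁ xs g
  ⨁-∙ []       f g = sym (identityˡ ε)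
  ⨁-∙ (x ∷ xs) f g = trans (∙-congˡ (⨁-∙ xs f g)) (interchange (f x) (g x) _ _)

  ⨁-swap : ∀ {X Y : Set} (xs : List X) (ys : List Y) (f : X → Y → Carrier) →
           ⨁ xs (λ x → ⨁ ys (f x)) ≈ ⨁ ys (λ y → ⨁ xs (λ x → f x y))
  ⨁-swap []       ys f = sym (⨁-ε ys)
  ⨁-swap (x ∷ xs) ys f = trans (∙-congˡ (⨁-swap xs ys f)) (sym (⨁-∙ ys (f x) _))

  ⨁-++ : ∀ {X : Set} (xs ys : List X) (f : X → Carrier) → ⨁ (xs ++ ys) f ≈ ⨁ xs f ∙ ⨁ ys f
  ⨁-++ []       ys f = sym (identityˡ _)
  ⨁-++ (x ∷ xs) ys f = trans (∙-congˡ (⨁-++ xs ys f)) (sym (assoc _ _ _))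

  ⨁-map : ∀ {X Y : Set} (h : X → Y) (xs : List X) (f : Y → Carrier) → ⨁ (map h xs) f ≡ ⨁ xs (f ∘ h)
  ⨁-map h xs f = List.foldr-map _ h ε xs

  ⨁-concatMap : ∀ {X Y : Set} (h : X → List Y) (xs : List X) (f : Y → Carrier) →
                ⨁ (concatMap h xs) f ≈ ⨁ xs (λ x → ⨁ (h x) f)
  ⨁-concatMap h []       f = refl
  ⨁-concatMap h (x ∷ xs) f = trans (⨁-++ (h x) _ f) (∙-congˡ (⨁-concatMap h xs f))

  ⨁-cartesianProductWith : ∀ {X Y Z : Set} (h : X → Y → Z) (xs : List X) (ys : List Y) (f : Z → Carrier) →
                           ⨁ (cartesianProductWith h xs ys) f ≈ ⨁ xs (λ x → ⨁ ys (λ y → f (h x y)))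
  ⨁-cartesianProductWith h []       ys f = refl
  ⨁-cartesianProductWith h (x ∷ xs) ys f = trans (⨁-++ (map (h x) ys) _ f)
    (∙-cong (reflexive (⨁-map (h x) ys f)) (⨁-cartesianProductWith h xs ys f))

  ⨁-tabulate : ∀ {X : Set} {n} (h : Fin n → X) (f : X → Carrier) →
               ⨁ (tabulate h) f ≡ ⨁ (allFin n) (f ∘ h)
  ⨁-tabulate {n = n} h f = ≡.trans
    (≡.cong (λ xs → ⨁ xs f) (≡.sym (List.map-tabulate id h))) (⨁-map h (allFin n) f)

  ⨁-suc : ∀ {n} (f : Fin (suc n) → Carrier) → ⨁ (allFin (suc n)) f ≡ f zero ∙ ⨁ (allFin n) (f ∘ suc)
  ⨁-suc f = ≡.cong (f zero ∙_) (⨁-tabulate suc f)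

  ⨁-lookup : ∀ {X : Set} (xs : List X) (f : X → Carrier) →
             ⨁ (allFin (length xs)) (f ∘ lookup xs) ≡ ⨁ xs f
  ⨁-lookup xs f = ≡.trans (≡.sym (⨁-tabulate (lookup xs) f)) (≡.cong (λ ys → ⨁ ys f) (List.tabulate-lookup xs))

  ⨁-filter : ∀ {X : Set} {P : X → Set} (P? : Decidable P) (xs : List X) (f : X → Carrier) →
             ⨁ (filter P? xs) f ≈ ⨁ xs (λ x → if does (P? x) then f x else ε)
  ⨁-filter P? []       f = refl
  ⨁-filter P? (x ∷ xs) f with does (P? x)
  ... | true  = ∙-congˡ (⨁-filter P? xs f)
  ... | false = trans (⨁-filter P? xs f) (sym (identityˡ _))

  ⨁-pick : ∀ {n} (j : Fin n) (f : Fin n → Carrier) →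
           ⨁ (allFin n) (λ i → if does (j Fin.≟ i) then f i else ε) ≈ f j
  ⨁-pick {suc n} zero f = begin
    ⨁ (allFin (suc n)) (λ i → if does (zero Fin.≟ i) then f i else ε)
      ≡⟨ ⨁-suc {n} (λ i → if does (zero Fin.≟ i) then f i else ε) ⟩
    f zero ∙ ⨁ (allFin n) (λ _ → ε)  ≈⟨ ∙-congˡ (⨁-ε (allFin n)) ⟩
    f zero ∙ ε                       ≈⟨ identityʳ _ ⟩
    f zero                           ∎
  ⨁-pick {suc n} (suc j) f = begin
    ⨁ (allFin (suc n)) (λ i → if does (suc j Fin.≟ i) then f i else ε)
      ≡⟨ ⨁-suc {n} (λ i → if does (suc j Fin.≟ i) then f i else ε) ⟩
    ε ∙ ⨁ (allFin n) (λ i → if does (j Fin.≟ i) then f (suc i) else ε)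
      ≈⟨ identityˡ _ ⟩
    ⨁ (allFin n) (λ i → if does (j Fin.≟ i) then f (suc i) else ε)
      ≈⟨ ⨁-pick j (f ∘ suc) ⟩
    f (suc j) ∎

module SemiringSums {c ℓ} (R : CommutativeSemiring c ℓ) where

  open CommutativeSemiring R hiding (zero)
  open SetoidReasoning setoid
  open import Algebra.Properties.Semiring.Exp semiring public using (_^_; ^-cong; ^-homo-*)

  open BigOperator +-commutativeMonoid public using () renaming
    ( ⨁ to ∑; ⨁-cong-∈ to ∑-cong-∈; ⨁-cong to ∑-cong; ⨁-ε to ∑-0; ⨁-∙ to ∑-+; ⨁-swap to ∑-swap
    ; ⨁-++ to ∑-++; ⨁-map to ∑-map; ⨁-concatMap to ∑-concatMap; ⨁-tabulate to ∑-tabulate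
    ; ⨁-cartesianProductWith to ∑-cartesianProductWith
    ; ⨁-suc to ∑-suc; ⨁-lookup to ∑-lookup; ⨁-filter to ∑-filter-if; ⨁-pick to ∑-pick-if )
  open BigOperator *-commutativeMonoid public using () renaming
    ( ⨁ to ∏; ⨁-cong to ∏-cong; ⨁-ε to ∏-1; ⨁-∙ to ∏-*; ⨁-tabulate to ∏-tabulate
    ; ⨁-suc to ∏-suc; ⨁-filter to ∏-filter-if; ⨁-pick to ∏-pick-if )

  -- The Iverson bracket. It depends on `does` alone, so logically equivalent decisions give the
  -- same value whatever their proofs are.
  [_] : ∀ {P : Set} → Dec P → Carrier
  [ P? ] = if does P? then 1# else 0#

  []-cong : ∀ {P Q : Set} (P? : Dec P) (Q? : Dec Q) → (P → Q) → (Q → P) → [ P? ] ≈ [ Q? ]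
  []-cong P? Q? f g = reflexive (≡.cong (λ b → if b then 1# else 0#) (does-⇔ (mk⇔ f g) P? Q?))

  []-true : ∀ {P : Set} (P? : Dec P) → P → [ P? ] ≈ 1#
  []-true P? p = reflexive (≡.cong (λ b → if b then 1# else 0#) (dec-true P? p))

  []-false : ∀ {P : Set} (P? : Dec P) → ¬ P → [ P? ] ≈ 0#
  []-false P? p = reflexive (≡.cong (λ b → if b then 1# else 0#) (dec-false P? p))

  []-× : ∀ {P Q : Set} (P? : Dec P) (Q? : Dec Q) → [ P? ×-dec Q? ] ≈ [ P? ] * [ Q? ]
  []-× P? Q? with does P?
  ... | true  = sym (*-identityˡ _)
  ... | false = sym (zeroˡ _)

  []-*-cong : ∀ {P : Set} (P? : Dec P) {a b} → (P → a ≈ b) → [ P? ] * a ≈ [ P? ] * b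
  []-*-cong (yes p) h = *-congˡ (h p)
  []-*-cong (no _)  h = trans (zeroˡ _) (sym (zeroˡ _))

  if-[] : ∀ {P : Set} (P? : Dec P) a → (if does P? then a else 0#) ≈ [ P? ] * a
  if-[] P? a with does P?
  ... | true  = sym (*-identityˡ _)
  ... | false = sym (zeroˡ _)

  ∑-filter : ∀ {X : Set} {P : X → Set} (P? : Decidable P) (xs : List X) (f : X → Carrier) →
             ∑ (filter P? xs) f ≈ ∑ xs (λ x → [ P? x ] * f x)
  ∑-filter P? xs f = trans (∑-filter-if P? xs f) (∑-cong xs λ x → if-[] (P? x) (f x))

  ∑-pick : ∀ {n} (j : Fin n) (f : Fin n → Carrier) → ∑ (allFin n) (λ i → [ j Fin.≟ i ] * f i) ≈ f j
  ∑-pick {n} j f = trans (∑-cong (allFin n) λ i → sym (if-[] (j Fin.≟ i) (f i))) (∑-pick-if j f)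

  ∑-[≟] : ∀ {n} (j : Fin n) → ∑ (allFin n) (λ i → [ j Fin.≟ i ]) ≈ 1#
  ∑-[≟] {n} j = trans (∑-cong (allFin n) λ i → sym (*-identityʳ _)) (∑-pick j λ _ → 1#)

  ∑-*ˡ : ∀ {X : Set} a (xs : List X) (f : X → Carrier) → ∑ xs (λ x → a * f x) ≈ a * ∑ xs f
  ∑-*ˡ a []       f = sym (zeroʳ a)
  ∑-*ˡ a (x ∷ xs) f = trans (+-congˡ (∑-*ˡ a xs f)) (sym (distribˡ a _ _))

  ∑-*ʳ : ∀ {X : Set} a (xs : List X) (f : X → Carrier) → ∑ xs (λ x → f x * a) ≈ ∑ xs f * a
  ∑-*ʳ a xs f = trans (∑-cong xs λ x → *-comm (f x) a) (trans (∑-*ˡ a xs f) (*-comm a _))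

  -- Distributivity, by induction on the number of factors. Every count of independent choices below
  -- is an instance of it.
  ∑-choices-∏ : ∀ {X : Set} m (xs : Fin m → List X) (g : Fin m → X → Carrier) →
                ∑ (choices m xs) (λ f → ∏ (allFin m) (λ i → g i (f i))) ≈
                ∏ (allFin m) (λ i → ∑ (xs i) (g i))
  ∑-choices-∏ zero    xs g = +-identityʳ 1#
  ∑-choices-∏ (suc m) xs g = begin
    ∑ (choices (suc m) xs) (λ f → ∏ (allFin (suc m)) (λ i → g i (f i)))
      ≈⟨ ∑-cartesianProductWith F._∷_ (xs zero) (choices m (xs ∘ suc)) _ ⟩
    ∑ (xs zero) (λ x → ∑ (choices m (xs ∘ suc)) λ f → ∏ (allFin (suc m)) (λ i → g i ((x F.∷ f) i)))
      ≈⟨ ∑-cong (xs zero) (λ x → trans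
           (∑-cong (choices m (xs ∘ suc)) λ f → reflexive (∏-suc {m} (λ i → g i ((x F.∷ f) i))))
           (trans (∑-*ˡ (g zero x) (choices m (xs ∘ suc)) _)
             (*-congˡ (∑-choices-∏ m (xs ∘ suc) (g ∘ suc))))) ⟩
    ∑ (xs zero) (λ x → g zero x * ∏ (allFin m) (λ i → ∑ (xs (suc i)) (g (suc i))))
      ≈⟨ ∑-*ʳ _ (xs zero) (g zero) ⟩
    ∑ (xs zero) (g zero) * ∏ (allFin m) (λ i → ∑ (xs (suc i)) (g (suc i)))
      ≡⟨ ≡.sym (∏-suc {m} λ i → ∑ (xs i) (g i)) ⟩
    ∏ (allFin (suc m)) (λ i → ∑ (xs i) (g i)) ∎

  []-∀ : ∀ {m} {P : Fin m → Set} (P? : Decidable P) → [ Fin.all? P? ] ≈ ∏ (allFin m) (λ i → [ P? i ])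
  []-∀ {zero}  P? = []-true (Fin.all? P?) λ ()
  []-∀ {suc m} P? = begin
    [ Fin.all? P? ]
      ≈⟨ []-cong (Fin.all? P?) (P? zero ×-dec Fin.all? (P? ∘ suc))
           (λ h → h zero , h ∘ suc) (uncurry Fin.∀-cons) ⟩
    [ P? zero ×-dec Fin.all? (P? ∘ suc) ]
      ≈⟨ []-× (P? zero) (Fin.all? (P? ∘ suc)) ⟩
    [ P? zero ] * [ Fin.all? (P? ∘ suc) ]
      ≈⟨ *-congˡ ([]-∀ (P? ∘ suc)) ⟩
    [ P? zero ] * ∏ (allFin m) (λ i → [ P? (suc i) ])
      ≡⟨ ≡.sym (∏-suc {m} λ i → [ P? i ]) ⟩
    ∏ (allFin (suc m)) (λ i → [ P? i ]) ∎

  ∑-choices-∀ : ∀ {X : Set} m (xs : Fin m → List X) {P : Fin m → X → Set} (P? : ∀ i → Decidable (P i)) →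
                ∑ (choices m xs) (λ f → [ Fin.all? (λ i → P? i (f i)) ]) ≈
                ∏ (allFin m) (λ i → ∑ (xs i) (λ x → [ P? i x ]))
  ∑-choices-∀ m xs P? = trans
    (∑-cong (choices m xs) λ f → []-∀ λ i → P? i (f i))
    (∑-choices-∏ m xs λ i x → [ P? i x ])

  ∏-const : ∀ m a → ∏ (allFin m) (λ _ → a) ≈ a ^ m
  ∏-const zero    a = refl
  ∏-const (suc m) a = trans (reflexive (∏-suc {m} λ _ → a)) (*-congˡ (∏-const m a))

  ∑-choices-1 : ∀ {X : Set} m (xs : List X) →
                ∑ (choices m λ _ → xs) (λ _ → 1#) ≈ ∑ xs (λ _ → 1#) ^ m
  ∑-choices-1 m xs = begin
    ∑ (choices m λ _ → xs) (λ _ → 1#)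
      ≈⟨ ∑-cong (choices m λ _ → xs) (λ _ → sym (∏-1 (allFin m))) ⟩
    ∑ (choices m λ _ → xs) (λ _ → ∏ (allFin m) λ _ → 1#)
      ≈⟨ ∑-choices-∏ m (λ _ → xs) (λ _ _ → 1#) ⟩
    ∏ (allFin m) (λ _ → ∑ xs (λ _ → 1#))
      ≈⟨ ∏-const m _ ⟩
    ∑ xs (λ _ → 1#) ^ m ∎

  -- The changed factor is described by a multiplier rather than a quotient, so a semiring suffices.
  -- The multiplier is a lost factorial factor in the counting of profiles and zero in the vanishing
  -- of a Lagrange basis function.
  ∏-update : ∀ {n} (j : Fin n) a (f g : Fin n → Carrier) →
             f j ≈ a * g j → (∀ i → i ≢ j → f i ≈ g i) →
             ∏ (allFin n) f ≈ a * ∏ (allFin n) g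
  ∏-update {n} j a f g p q = begin
    ∏ (allFin n) f
      ≈⟨ ∏-cong (allFin n) scaled ⟩
    ∏ (allFin n) (λ i → (if does (j Fin.≟ i) then a else 1#) * g i)
      ≈⟨ ∏-* (allFin n) _ g ⟩
    ∏ (allFin n) (λ i → if does (j Fin.≟ i) then a else 1#) * ∏ (allFin n) g
      ≈⟨ *-congʳ (∏-pick-if j λ _ → a) ⟩
    a * ∏ (allFin n) g ∎
    where
    scaled : ∀ i → f i ≈ (if does (j Fin.≟ i) then a else 1#) * g i
    scaled i with j Fin.≟ i
    ... | yes ≡.refl = p
    ... | no  j≢i    = trans (q i (j≢i ∘ ≡.sym)) (sym (*-identityˡ _))

  ∏-^ : ∀ {n} a (f : Fin n → ℕ) → ∏ (allFin n) (λ i → a ^ f i) ≈ a ^ ∑ℕ f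
  ∏-^ {zero}  a f = refl
  ∏-^ {suc n} a f = trans (reflexive (∏-suc {n} λ i → a ^ f i))
    (trans (*-congˡ (∏-^ a (f ∘ suc))) (sym (^-homo-* a (f zero) (∑ℕ (f ∘ suc)))))

-- Profiles are counted in ℕ, where nonzero factorials can be cancelled; `ιℕ` later carries the
-- counts into the algebra.
module ℕΣ = SemiringSums ℕ.+-*-commutativeSemiring

-- Lagrange interpolation

module ℚAlgebraSolver {c ℓ} (K : ℚAlgebra c ℓ) where

  open ℚAlgebra K
  open RingMorphisms.IsRingHomomorphism ι-hom

  ι-morphism : CommutativeRing.rawRing ℚ.+-*-commutativeRing -Raw-AlmostCommutative⟶ fromCommutativeRing commutativeRing
  ι-morphism = record
    { ⟦_⟧ = ι ; +-homo = +-homo ; *-homo = *-homo ; -‿homo = -‿homo ; 0-homo = 0#-homo ; 1-homo = 1#-homo }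

  open RingSolver _ _ ι-morphism
    (λ a b → Maybe.map ⟦⟧-cong (dec⇒maybe (a ℚ.≟ b))) public

module Interpolation {c ℓ} (K : ℚAlgebra c ℓ) where

  open ℚAlgebra K hiding (∑; ∏; _^_)
  open CommutativeRing commutativeRing using (refl; sym; trans)
  open SemiringSums commutativeSemiring
  open ℚAlgebraSolver K using (solve; _:+_; _:*_; _:-_; _:=_; con)
  open SetoidReasoning setoid

  open import Algebra.Properties.AbelianGroup +-abelianGroup using () renaming (∙-cancelʳ to +-cancelʳ)

  -- Polynomial functions of degree < n, described by divided differences.
  DegreeBelow : ℕ → (Carrier → Carrier) → Set (c ⊔ ℓ)
  DegreeBelow zero    f = Level.Lift c (∀ q → f q ≈ 0#)
  DegreeBelow (suc n) f = ∀ a → ∃ λ g → DegreeBelow n g × ∀ q → f q ≈ f a + (q - a) * g q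

  deg-resp : ∀ n {f g} → (∀ q → f q ≈ g q) → DegreeBelow n f → DegreeBelow n g
  deg-resp zero    e (Level.lift h) = Level.lift λ q → trans (sym (e q)) (h q)
  deg-resp (suc n) e F a with F a
  ... | f′ , F′ , h = f′ , F′ , λ q → trans (sym (e q)) (trans (h q) (+-congʳ (e a)))

  deg-0 : ∀ n → DegreeBelow n (λ _ → 0#)
  deg-0 zero    = Level.lift λ _ → refl
  deg-0 (suc n) a = (λ _ → 0#) , deg-0 n , λ q → sym (trans (+-identityˡ _) (zeroʳ (q - a)))

  deg-suc : ∀ n {f} → DegreeBelow n f → DegreeBelow (suc n) f
  deg-suc zero    (Level.lift h) = deg-resp 1 (λ q → sym (h q)) (deg-0 1)
  deg-suc (suc n) F a with F a
  ... | f′ , F′ , h = f′ , deg-suc n F′ , h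

  deg-+ : ∀ n {f g} → DegreeBelow n f → DegreeBelow n g → DegreeBelow n (λ q → f q + g q)
  deg-+ zero    (Level.lift h) (Level.lift k) = Level.lift λ q → trans (+-cong (h q) (k q)) (+-identityˡ 0#)
  deg-+ (suc n) {f} {g} F G a with F a | G a
  ... | f′ , F′ , h | g′ , G′ , k = (λ q → f′ q + g′ q) , deg-+ n F′ G′ , λ q → trans (+-cong (h q) (k q))
    (solve 5 (λ fa ga d u v → (fa :+ d :* u) :+ (ga :+ d :* v) := (fa :+ ga) :+ d :* (u :+ v)) refl
      (f a) (g a) (q - a) (f′ q) (g′ q))

  deg-* : ∀ n b {f} → DegreeBelow n f → DegreeBelow n (λ q → b * f q)
  deg-* zero    b (Level.lift h) = Level.lift λ q → trans (*-congˡ (h q)) (zeroʳ b)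
  deg-* (suc n) b {f} F a with F a
  ... | f′ , F′ , h = (λ q → b * f′ q) , deg-* n b F′ , λ q → trans (*-congˡ (h q))
    (solve 4 (λ b fa d u → b :* (fa :+ d :* u) := b :* fa :+ d :* (b :* u)) refl b (f a) (q - a) (f′ q))

  -- Writing `q - b` as `(q - a) + (a - b)` shows that the divided difference at `a` is
  -- `f q + (a - b) * f′ q`.
  deg-linear : ∀ n b {f} → DegreeBelow n f → DegreeBelow (suc n) (λ q → (q - b) * f q)
  deg-linear zero    b (Level.lift h) = deg-resp 1 (λ q → sym (trans (*-congˡ (h q)) (zeroʳ (q - b)))) (deg-0 1)
  deg-linear (suc n) b {f} F a with F a
  ... | f′ , F′ , h = (λ q → f q + (a - b) * f′ q) , deg-+ (suc n) F (deg-suc n (deg-* n (a - b) F′)) , λ q → begin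
    (q - b) * f q
      ≈⟨ solve 4 (λ q a b fq → (q :- b) :* fq := (q :- a) :* fq :+ (a :- b) :* fq) refl q a b (f q) ⟩
    (q - a) * f q + (a - b) * f q
      ≈⟨ +-congˡ (*-congˡ (h q)) ⟩
    (q - a) * f q + (a - b) * (f a + (q - a) * f′ q)
      ≈⟨ solve 6 (λ q a b fq fa u → (q :- a) :* fq :+ (a :- b) :* (fa :+ (q :- a) :* u) :=
                                     (a :- b) :* fa :+ (q :- a) :* (fq :+ (a :- b) :* u)) refl q a b (f q) (f a) (f′ q) ⟩
    (a - b) * f a + (q - a) * (f q + (a - b) * f′ q) ∎

  deg-const : ∀ n b → DegreeBelow (suc n) (λ _ → b)
  deg-const n b a = (λ _ → 0#) , deg-0 n , λ q → sym (trans (+-congˡ (zeroʳ (q - a))) (+-identityʳ b))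

  deg-^ : ∀ {k n} → k ℕ.< n → DegreeBelow n (_^ k)
  deg-^ {zero}  {suc n} _   = deg-const n 1#
  deg-^ {suc k} {suc n} k<n = deg-resp (suc n)
    -- The root is written `ι ℚ.0ℚ` because that is what the solver's constant denotes.
    (λ q → *-congʳ (solve 1 (λ q → q :- con ℚ.0ℚ := q) refl q))
    (deg-linear n (ι ℚ.0ℚ) (deg-^ (ℕ.s<s⁻¹ k<n)))

  deg-∑ : ∀ n {X : Set} (xs : List X) {f : X → Carrier → Carrier} → (∀ x → DegreeBelow n (f x)) →
          DegreeBelow n (λ q → ∑ xs (λ x → f x q))
  deg-∑ n []       F = deg-0 n
  deg-∑ n (x ∷ xs) F = deg-+ n (F x) (deg-∑ n xs F)

  deg-∏-linear : ∀ n (p w : Fin n → Carrier) →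
                 DegreeBelow (suc n) (λ q → ∏ (allFin n) λ i → (q - p i) * w i)
  deg-∏-linear zero    p w = deg-const 0 1#
  deg-∏-linear (suc n) p w = deg-resp (suc (suc n))
    (λ q → trans (solve 3 (λ d w π → d :* (w :* π) := (d :* w) :* π) refl (q - p zero) (w zero) _)
                 (sym (reflexive (∏-suc {n} λ i → (q - p i) * w i))))
    (deg-linear (suc n) (p zero) (deg-* (suc n) (w zero) (deg-∏-linear n (p ∘ suc) (w ∘ suc))))

  ∏-others : ∀ {n} (i : Fin n) (h : Fin n → Carrier) →
             ∏ (others i) h ≈ ∏ (allFin n) (λ j → if does (¬? (j Fin.≟ i)) then h j else 1#)
  ∏-others {n} i h = ∏-filter-if (λ j → ¬? (j Fin.≟ i)) (allFin n) h

  ∏-others-zero : ∀ n (h : Fin (suc n) → Carrier) → ∏ (others zero) h ≈ ∏ (allFin n) (h ∘ suc)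
  ∏-others-zero n h = trans (∏-others zero h)
    (trans (reflexive (∏-suc {n} λ j → if does (¬? (j Fin.≟ zero)) then h j else 1#)) (*-identityˡ _))

  ∏-others-suc : ∀ {n} (i : Fin n) (h : Fin (suc n) → Carrier) →
                 ∏ (others (suc i)) h ≈ h zero * ∏ (others i) (h ∘ suc)
  ∏-others-suc {n} i h = trans (∏-others (suc i) h)
    (trans (reflexive (∏-suc {n} λ j → if does (¬? (j Fin.≟ suc i)) then h j else 1#))
           (*-congˡ (sym (∏-others i (h ∘ suc)))))

  -- `w i j` stands for the reciprocal of `p i - p j`; passing it as data avoids division in the
  -- ring.
  lagrange : ∀ {n} (p : Fin n → Carrier) (w : Fin n → Fin n → Carrier) → Fin n → Carrier → Carrier
  lagrange p w i q = ∏ (others i) λ j → (q - p j) * w i j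

  -- Induction on the number of nodes: the divided difference at the first node has smaller degree
  -- and is interpolated at the remaining ones. No cancellation of ring elements under
  -- multiplication is used, so zero divisors do no harm.
  interpolation : ∀ n (p : Fin n → Carrier) (w : Fin n → Fin n → Carrier) →
                  (∀ i j → i ≢ j → w i j * (p i - p j) ≈ 1#) →
                  ∀ f → DegreeBelow n f → ∀ q → f q ≈ ∑ (allFin n) λ i → lagrange p w i q * f (p i)
  interpolation zero    p w inv f (Level.lift h) q = h q
  interpolation (suc n) p w inv f F q = begin
    -- Newton's formula gives `f p₀` the coefficient `1# - S`. With `S * f p₀` added to both sides,
    -- `partition-of-unity` identifies this coefficient with `L₀ q`.
    f q                           ≈⟨ +-cancelʳ (S * f p₀) (f q) _ (begin
      f q + S * f p₀                        ≈⟨ newton f F ⟩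
      f p₀ + T                              ≈⟨ +-congʳ (sym (*-identityˡ (f p₀))) ⟩
      1# * f p₀ + T                         ≈⟨ +-congʳ (*-congʳ (sym partition-of-unity)) ⟩
      (L₀ q + S) * f p₀ + T
        ≈⟨ solve 4 (λ l s a t → (l :+ s) :* a :+ t := (l :* a :+ t) :+ s :* a) refl (L₀ q) S (f p₀) T ⟩
      (L₀ q * f p₀ + T) + S * f p₀          ∎) ⟩
    L₀ q * f p₀ + T               ≈⟨ +-congʳ (*-congʳ (sym (∏-others-zero n λ j → (q - p j) * w zero j))) ⟩
    lagrange p w zero q * f p₀ + T ≡⟨ ≡.sym (∑-suc {n} λ i → lagrange p w i q * f (p i)) ⟩
    ∑ (allFin (suc n)) (λ i → lagrange p w i q * f (p i)) ∎
    where
    p₀ : Carrier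
    p₀ = p zero
    L₀ : Carrier → Carrier
    L₀ q = ∏ (allFin n) λ j → (q - p (suc j)) * w zero (suc j)
    L : Fin n → Carrier
    L i = lagrange p w (suc i) q
    S T : Carrier
    S = ∑ (allFin n) L
    T = ∑ (allFin n) λ i → L i * f (p (suc i))

    -- It is stated for every function of this degree, not only the given one, because it is applied
    -- a second time to `L₀`.
    newton : ∀ f → DegreeBelow (suc n) f →
             f q + S * f p₀ ≈ f p₀ + ∑ (allFin n) (λ i → L i * f (p (suc i)))
    newton f F with F p₀
    ... | g , G , h = begin
      f q + S * f p₀
        ≈⟨ +-congʳ (h q) ⟩
      (f p₀ + (q - p₀) * g q) + S * f p₀
        ≈⟨ +-assoc _ _ _ ⟩
      f p₀ + ((q - p₀) * g q + S * f p₀)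
        ≈⟨ +-congˡ (+-cong
             (trans (*-congˡ (interpolation n (p ∘ suc) (λ i j → w (suc i) (suc j))
                               (λ i j i≢j → inv (suc i) (suc j) (i≢j ∘ Fin.suc-injective)) g G q))
                    (sym (∑-*ˡ (q - p₀) (allFin n) _)))
             (sym (∑-*ʳ (f p₀) (allFin n) L))) ⟩
      f p₀ + (∑ (allFin n) (λ i → (q - p₀) * (L′ i * g (p (suc i)))) + ∑ (allFin n) (λ i → L i * f p₀))
        ≈⟨ +-congˡ (trans (sym (∑-+ (allFin n) _ _)) (∑-cong (allFin n) node)) ⟩
      f p₀ + ∑ (allFin n) (λ i → L i * f (p (suc i))) ∎
      where
      L′ : Fin n → Carrier
      L′ i = lagrange (p ∘ suc) (λ i j → w (suc i) (suc j)) i q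
      node : ∀ i → (q - p₀) * (L′ i * g (p (suc i))) + L i * f p₀ ≈ L i * f (p (suc i))
      node i = begin
        (q - p₀) * (L′ i * g pᵢ) + L i * f p₀
          -- The inserted `1#` is split in two: `w (suc i) zero` completes the factor by which `L i`
          -- exceeds `L′ i`, and `pᵢ - p₀` turns `g pᵢ` back into the increment of `f`.
          ≈⟨ +-congʳ (*-congˡ (*-congˡ (trans (sym (*-identityˡ (g pᵢ))) (*-congʳ (sym (inv (suc i) zero λ ())))))) ⟩
        (q - p₀) * (L′ i * ((w (suc i) zero * (pᵢ - p₀)) * g pᵢ)) + L i * f p₀
          ≈⟨ +-congʳ (solve 5 (λ d l w e g → d :* (l :* ((w :* e) :* g)) := ((d :* w) :* l) :* (e :* g)) refl
               (q - p₀) (L′ i) (w (suc i) zero) (pᵢ - p₀) (g pᵢ)) ⟩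
        (((q - p₀) * w (suc i) zero) * L′ i) * ((pᵢ - p₀) * g pᵢ) + L i * f p₀
          ≈⟨ +-congʳ (*-congʳ (sym (∏-others-suc i λ j → (q - p j) * w (suc i) j))) ⟩
        L i * ((pᵢ - p₀) * g pᵢ) + L i * f p₀
          ≈⟨ sym (distribˡ (L i) _ _) ⟩
        L i * ((pᵢ - p₀) * g pᵢ + f p₀)
          ≈⟨ *-congˡ (trans (+-comm _ _) (sym (h pᵢ))) ⟩
        L i * f pᵢ ∎
        where
        pᵢ : Carrier
        pᵢ = p (suc i)

    L₀-p₀ : L₀ p₀ ≈ 1#
    L₀-p₀ = trans (∏-cong (allFin n) λ j → trans (*-comm _ _) (inv zero (suc j) λ ())) (∏-1 (allFin n))

    L₀-node : ∀ i → L₀ (p (suc i)) ≈ 0#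
    L₀-node i = trans
      (∏-update i 0# _ (λ j → (p (suc i) - p (suc j)) * w zero (suc j))
        (trans (trans (*-congʳ (-‿inverseʳ _)) (zeroˡ _)) (sym (zeroˡ _))) λ _ _ → refl)
      (zeroˡ _)

    -- Newton's formula for L₀ itself, which has degree n.
    partition-of-unity : L₀ q + S ≈ 1#
    partition-of-unity = begin
      L₀ q + S            ≈⟨ +-congˡ (trans (sym (*-identityʳ S)) (*-congˡ (sym L₀-p₀))) ⟩
      L₀ q + S * L₀ p₀    ≈⟨ newton L₀ (deg-∏-linear n (p ∘ suc) (w zero ∘ suc)) ⟩
      L₀ p₀ + ∑ (allFin n) (λ i → L i * L₀ (p (suc i)))
        ≈⟨ +-cong L₀-p₀ (trans (∑-cong (allFin n) λ i → trans (*-congˡ (L₀-node i)) (zeroʳ (L i))) (∑-0 (allFin n))) ⟩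
      1# + 0#             ≈⟨ +-identityʳ 1# ⟩
      1#                  ∎

-- Counting colourings with prescribed block profile

module Profiles where

  open import Relation.Binary.PropositionalEquality using (refl; sym; trans; module ≡-Reasoning)
  open import Data.Nat.Base using (_+_; _*_)
  open ℕΣ

  ∑ℕ≡∑ : ∀ {m} (f : Fin m → ℕ) → ∑ℕ f ≡ ∑ (allFin m) f
  ∑ℕ≡∑ f = ∑-tabulate f id

  ∏ℕ≡∏ : ∀ {m} (f : Fin m → ℕ) → ∏ℕ f ≡ ∏ (allFin m) f
  ∏ℕ≡∏ f = ∏-tabulate f id

  term≤∑ : ∀ {m} (f : Fin m → ℕ) i → f i ≤ ∑ (allFin m) f
  term≤∑ {suc m} f zero    rewrite ∑-suc f = ℕ.m≤m+n (f zero) _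
  term≤∑ {suc m} f (suc i) rewrite ∑-suc f = ℕ.≤-trans (term≤∑ (f ∘ suc) i) (ℕ.m≤n+m _ (f zero))

  ∏≢0 : ∀ {m} (f : Fin m → ℕ) → (∀ i → ℕ.NonZero (f i)) → ℕ.NonZero (∏ (allFin m) f)
  ∏≢0 {zero}  f h = _
  ∏≢0 {suc m} f h rewrite ∏-suc f = ℕ.m*n≢0 (f zero) _ {{h zero}} {{∏≢0 (f ∘ suc) (h ∘ suc)}}

  ∑-1 : ∀ m → ∑ (allFin m) (λ _ → 1) ≡ m
  ∑-1 zero    = refl
  ∑-1 (suc m) = trans (∑-suc {m} λ _ → 1) (cong suc (∑-1 m))

  _≐?_ : ∀ {r p} (a α : Fin r → Fin p → ℕ) → Dec (∀ u s → a u s ≡ α u s)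
  a ≐? α = Fin.all? λ u → Fin.all? λ s → a u s ℕ.≟ α u s

  colourings : ∀ n p → List (Fin n → Fin p)
  colourings n p = choices n λ _ → allFin p

  fibreSize : ∀ {n r} → (Fin n → Fin r) → Fin r → ℕ
  fibreSize {n} b u = ∑ (allFin n) λ i → [ b i Fin.≟ u ]

  profile : ∀ {n r p} → (Fin n → Fin r) → (Fin n → Fin p) → Fin r → Fin p → ℕ
  profile {n} b c u s = ∑ (allFin n) λ i → [ b i Fin.≟ u ] * [ c i Fin.≟ s ]

  profile-row : ∀ {n r p} (b : Fin n → Fin r) (c : Fin n → Fin p) u →
                ∑ (allFin p) (profile b c u) ≡ fibreSize b u
  profile-row {n} {p = p} b c u = begin
    ∑ (allFin p) (λ s → ∑ (allFin n) λ i → [ b i Fin.≟ u ] * [ c i Fin.≟ s ])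
      ≡⟨ ∑-swap (allFin p) (allFin n) _ ⟩
    ∑ (allFin n) (λ i → ∑ (allFin p) λ s → [ b i Fin.≟ u ] * [ c i Fin.≟ s ])
      ≡⟨ ∑-cong (allFin n) (λ i → trans (∑-*ˡ [ b i Fin.≟ u ] (allFin p) _)
           (trans (cong ([ b i Fin.≟ u ] *_) (∑-[≟] (c i))) (ℕ.*-identityʳ _))) ⟩
    fibreSize b u ∎
    where open ≡-Reasoning

  count : ∀ {n r p} → (Fin n → Fin r) → (Fin r → Fin p → ℕ) → ℕ
  count {n} {p = p} b a = ∑ (colourings n p) λ c → [ a ≐? profile b c ]

  factorials : ∀ {r p} → (Fin r → Fin p → ℕ) → ℕ
  factorials {r} {p} a = ∏ (allFin r) λ u → ∏ (allFin p) λ s → a u s !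

  module Recolour {n r p} (b : Fin (suc n) → Fin r) (s : Fin p) where

    b₀ : Fin r
    b₀ = b zero

    δ : Fin r → Fin p → ℕ
    δ u s′ = [ b₀ Fin.≟ u ] * [ s Fin.≟ s′ ]

    δ-same : δ b₀ s ≡ 1
    δ-same = cong₂ _*_ ([]-true (b₀ Fin.≟ b₀) refl) ([]-true (s Fin.≟ s) refl)

    δ-row : ∀ u → u ≢ b₀ → ∀ s′ → δ u s′ ≡ 0
    δ-row u u≢ s′ = cong (_* [ s Fin.≟ s′ ]) ([]-false (b₀ Fin.≟ u) (u≢ ∘ sym))

    δ-column : ∀ u s′ → s′ ≢ s → δ u s′ ≡ 0
    δ-column u s′ s′≢ = trans (cong ([ b₀ Fin.≟ u ] *_) ([]-false (s Fin.≟ s′) (s′≢ ∘ sym))) (ℕ.*-zeroʳ [ b₀ Fin.≟ u ])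

    profile-∷ : ∀ c u s′ → profile b (s F.∷ c) u s′ ≡ δ u s′ + profile (b ∘ suc) c u s′
    profile-∷ c u s′ = ∑-suc λ i → [ b i Fin.≟ u ] * [ (s F.∷ c) i Fin.≟ s′ ]

    module _ (a : Fin r → Fin p → ℕ) {k} (a₀ : a b₀ s ≡ suc k) where

      -- The profile still to be realised by the other vertices once vertex `zero` has colour `s`.
      -- Since the entry at `b₀` and `s` is positive, the truncated subtraction is exact.
      a⁻ : Fin r → Fin p → ℕ
      a⁻ u s′ = a u s′ ∸ δ u s′

      δ≤a : ∀ u s′ → δ u s′ ≤ a u s′
      δ≤a u s′ with u Fin.≟ b₀ | s′ Fin.≟ s
      ... | yes refl | yes refl = ℕ.≤-trans (ℕ.≤-reflexive δ-same) (ℕ.≤-trans (s≤s z≤n) (ℕ.≤-reflexive (sym a₀)))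
      ... | no u≢    | _        = ℕ.≤-trans (ℕ.≤-reflexive (δ-row u u≢ s′)) z≤n
      ... | yes _    | no s′≢   = ℕ.≤-trans (ℕ.≤-reflexive (δ-column u s′ s′≢)) z≤n

      bracket : ∀ c → [ a ≐? profile b (s F.∷ c) ] ≡ [ a⁻ ≐? profile (b ∘ suc) c ]
      bracket c = []-cong (a ≐? profile b (s F.∷ c)) (a⁻ ≐? profile (b ∘ suc) c)
        (λ h u s′ → trans (cong (_∸ δ u s′) (trans (h u s′) (profile-∷ c u s′))) (ℕ.m+n∸m≡n (δ u s′) _))
        (λ h u s′ → trans (sym (ℕ.m+[n∸m]≡n (δ≤a u s′))) (trans (cong (_+_ (δ u s′)) (h u s′)) (sym (profile-∷ c u s′))))

      factorials-a⁻ : factorials a ≡ suc k * factorials a⁻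
      factorials-a⁻ = ∏-update b₀ (suc k) (λ u → ∏ (allFin p) λ s′ → a u s′ !) (λ u → ∏ (allFin p) λ s′ → a⁻ u s′ !)
        (∏-update s (suc k) (λ s′ → a b₀ s′ !) (λ s′ → a⁻ b₀ s′ !)
          (trans (cong _! a₀) (cong (λ m → suc k * m !) (sym (cong₂ _∸_ a₀ δ-same))))
          λ s′ s′≢ → cong (λ d → (a b₀ s′ ∸ d) !) (sym (δ-column b₀ s′ s′≢)))
        (λ u u≢ → ∏-cong (allFin p) λ s′ → cong (λ d → (a u s′ ∸ d) !) (sym (δ-row u u≢ s′)))

      a⁻-row : ∀ u → ∑ (allFin p) (a u) ≡ fibreSize b u → ∑ (allFin p) (a⁻ u) ≡ fibreSize (b ∘ suc) u
      a⁻-row u h = ℕ.+-cancelˡ-≡ [ b₀ Fin.≟ u ] _ _ (begin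
        [ b₀ Fin.≟ u ] + ∑ (allFin p) (a⁻ u)
          ≡⟨ cong (_+ ∑ (allFin p) (a⁻ u)) (sym (trans (∑-*ˡ [ b₀ Fin.≟ u ] (allFin p) _)
               (trans (cong ([ b₀ Fin.≟ u ] *_) (∑-[≟] s)) (ℕ.*-identityʳ _)))) ⟩
        ∑ (allFin p) (δ u) + ∑ (allFin p) (a⁻ u)
          ≡⟨ sym (∑-+ (allFin p) (δ u) (a⁻ u)) ⟩
        ∑ (allFin p) (λ s′ → δ u s′ + a⁻ u s′)
          ≡⟨ ∑-cong (allFin p) (λ s′ → ℕ.m+[n∸m]≡n (δ≤a u s′)) ⟩
        ∑ (allFin p) (a u)
          ≡⟨ h ⟩
        fibreSize b u
          ≡⟨ ∑-suc (λ i → [ b i Fin.≟ u ]) ⟩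
        [ b₀ Fin.≟ u ] + fibreSize (b ∘ suc) u ∎)
        where open ≡-Reasoning

  fibreSize-factorials : ∀ {n r} (b : Fin (suc n) → Fin r) →
    ∏ (allFin r) (λ u → fibreSize b u !) ≡ fibreSize b (b zero) * ∏ (allFin r) (λ u → fibreSize (b ∘ suc) u !)
  fibreSize-factorials b = ∏-update (b zero) (fibreSize b (b zero)) (λ u → fibreSize b u !) (λ u → fibreSize (b ∘ suc) u !)
    (trans (cong _! same) (cong (_* fibreSize (b ∘ suc) (b zero) !) (sym same)))
    λ u u≢ → cong _! (trans (∑-suc (λ i → [ b i Fin.≟ u ])) (cong (_+ fibreSize (b ∘ suc) u) ([]-false (b zero Fin.≟ u) (u≢ ∘ sym))))
    where
    same : fibreSize b (b zero) ≡ suc (fibreSize (b ∘ suc) (b zero))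
    same = trans (∑-suc (λ i → [ b i Fin.≟ b zero ])) (cong (_+ fibreSize (b ∘ suc) (b zero)) ([]-true (b zero Fin.≟ b zero) refl))

  -- Induction on the vertices, split by the colour `s` of vertex `zero`. Removing that vertex takes
  -- the factor `a (b zero) s` out of the factorials, so colour `s` contributes this entry times the
  -- smaller product; the row sum then restores the block size, which is the factor lost on the
  -- right.
  count-factorials : ∀ n {r p} (b : Fin n → Fin r) (a : Fin r → Fin p → ℕ) →
                     (∀ u → ∑ (allFin p) (a u) ≡ fibreSize b u) →
                     count b a * factorials a ≡ ∏ (allFin r) λ u → fibreSize b u !
  count-factorials zero {r} {p} b a rows = trans
    (cong₂ _*_
      (trans (ℕ.+-identityʳ _) ([]-true (a ≐? profile b (λ ())) a≡0))
      (∏-cong (allFin r) λ u → trans (∏-cong (allFin p) λ s → cong _! (a≡0 u s)) (∏-1 (allFin p))))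
    (ℕ.*-identityˡ _)
    where
    a≡0 : ∀ u s → a u s ≡ 0
    a≡0 u s = ℕ.n≤0⇒n≡0 (ℕ.≤-trans (term≤∑ (a u) s) (ℕ.≤-reflexive (rows u)))
  count-factorials (suc n) {r} {p} b a rows = begin
    count b a * factorials a
      ≡⟨ cong (_* factorials a) (∑-cartesianProductWith F._∷_ (allFin p) (colourings n p) λ c → [ a ≐? profile b c ]) ⟩
    ∑ (allFin p) (λ s → ∑ (colourings n p) λ c → [ a ≐? profile b (s F.∷ c) ]) * factorials a
      ≡⟨ sym (∑-*ʳ (factorials a) (allFin p) _) ⟩
    ∑ (allFin p) (λ s → ∑ (colourings n p) (λ c → [ a ≐? profile b (s F.∷ c) ]) * factorials a)
      ≡⟨ ∑-cong (allFin p) first ⟩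
    ∑ (allFin p) (λ s → a (b zero) s * N!)
      ≡⟨ ∑-*ʳ N! (allFin p) (a (b zero)) ⟩
    ∑ (allFin p) (a (b zero)) * N!
      ≡⟨ cong (_* N!) (rows (b zero)) ⟩
    fibreSize b (b zero) * N!
      ≡⟨ sym (fibreSize-factorials b) ⟩
    ∏ (allFin r) (λ u → fibreSize b u !) ∎
    where
    open ≡-Reasoning
    N! : ℕ
    N! = ∏ (allFin r) λ u → fibreSize (b ∘ suc) u !
    first : ∀ s → ∑ (colourings n p) (λ c → [ a ≐? profile b (s F.∷ c) ]) * factorials a ≡ a (b zero) s * N!
    first s with a (b zero) s in eq
    -- Giving vertex `zero` the colour `s` makes this profile entry positive, so no such colouring
    -- has profile `a`.
    ... | zero = cong (_* factorials a) (trans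
          (∑-cong (colourings n p) λ c → []-false (a ≐? profile b (s F.∷ c)) (λ h →
            ℕ.0≢1+n (trans (sym eq) (trans (h (b zero) s) (trans (profile-∷ c (b zero) s) (cong (_+ profile (b ∘ suc) c (b zero) s) δ-same))))))
          (∑-0 (colourings n p)))
      where open Recolour b s
    ... | suc k = begin
      ∑ (colourings n p) (λ c → [ a ≐? profile b (s F.∷ c) ]) * factorials a
        ≡⟨ cong₂ _*_ (∑-cong (colourings n p) (bracket a eq)) (factorials-a⁻ a eq) ⟩
      count (b ∘ suc) (a⁻ a eq) * (suc k * factorials (a⁻ a eq))
        ≡⟨ trans (sym (ℕ.*-assoc m (suc k) f)) (trans (cong (_* f) (ℕ.*-comm m (suc k))) (ℕ.*-assoc (suc k) m f)) ⟩
      suc k * (count (b ∘ suc) (a⁻ a eq) * factorials (a⁻ a eq))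
        ≡⟨ cong (suc k *_) (count-factorials n (b ∘ suc) (a⁻ a eq) λ u → a⁻-row a eq u (rows u)) ⟩
      suc k * N! ∎
      where
      open Recolour b s
      m f : ℕ
      m = count (b ∘ suc) (a⁻ a eq)
      f = factorials (a⁻ a eq)

  -- The division in `multinomial` leaves no remainder because its quotient counts something:
  -- colourings of `N` vertices forming a single block.
  multinomial-exact : ∀ {p} N (a : Fin p → ℕ) → ∑ (allFin p) a ≡ N →
                      multinomial N a * ∏ℕ (λ s → a s !) ≡ N !
  multinomial-exact {p} N a row = trans (cong (_* D) quotient) exact
    where
    b : Fin N → Fin 1
    b _ = zero
    D k : ℕ
    D = ∏ℕ λ s → a s !
    k = count b λ _ → a
    size : fibreSize b zero ≡ N
    size = ∑-1 N
    exact : k * D ≡ N !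
    exact = begin
      k * D                            ≡⟨ cong (k *_) (trans (∏ℕ≡∏ λ s → a s !) (sym (ℕ.*-identityʳ _))) ⟩
      k * factorials {1} (λ _ → a)     ≡⟨ count-factorials N b (λ _ → a) (λ { zero → trans row (sym size) }) ⟩
      fibreSize b zero ! * 1           ≡⟨ trans (ℕ.*-identityʳ _) (cong _! size) ⟩
      N !                              ∎
      where open ≡-Reasoning
    quotient : multinomial N a ≡ k
    quotient = trans (/-congˡ {{∏!-nonZero a}} (sym exact)) (m*n/n≡m k D {{∏!-nonZero a}})

  count-multinomial : ∀ {n r p} (b : Fin n → Fin r) (a : Fin r → Fin p → ℕ) →
                      (∀ u → ∑ (allFin p) (a u) ≡ fibreSize b u) →
                      count b a ≡ ∏ℕ λ u → multinomial (fibreSize b u) (a u)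
  count-multinomial {n} {r} {p} b a rows = ℕ.*-cancelʳ-≡ _ _ (factorials a)
    {{∏≢0 _ λ u → ∏≢0 _ λ s → (a u s) ℕ.!≢0}} (begin
    count b a * factorials a
      ≡⟨ count-factorials n b a rows ⟩
    ∏ (allFin r) (λ u → fibreSize b u !)
      ≡⟨ ∏-cong (allFin r) (λ u → sym (multinomial-exact (fibreSize b u) (a u) (rows u))) ⟩
    ∏ (allFin r) (λ u → multinomial (fibreSize b u) (a u) * ∏ℕ (λ s → a u s !))
      ≡⟨ ∏-* (allFin r) (λ u → multinomial (fibreSize b u) (a u)) (λ u → ∏ℕ (λ s → a u s !)) ⟩
    ∏ (allFin r) (λ u → multinomial (fibreSize b u) (a u)) * ∏ (allFin r) (λ u → ∏ℕ (λ s → a u s !))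
      ≡⟨ cong₂ _*_ (sym (∏ℕ≡∏ λ u → multinomial (fibreSize b u) (a u)))
           (∏-cong (allFin r) λ u → ∏ℕ≡∏ λ s → a u s !) ⟩
    ∏ℕ (λ u → multinomial (fibreSize b u) (a u)) * factorials a ∎)
    where open ≡-Reasoning

open Profiles

-- Ranks of graphical arrangements

open ℝ-LinearAlgebra using (Labelling; labelling; merge; ⋂; diagonal)

Respects : ∀ {n m} {X : Set} → (Fin m → Fin n × Fin n) → Subset m → (Fin n → X) → Set
Respects e B c = ∀ k → k ∈ B → c (proj₁ (e k)) ≡ c (proj₂ (e k))

respects? : ∀ {n m p} (e : Fin m → Fin n × Fin n) (B : Subset m) (c : Fin n → Fin p) → Dec (Respects e B c)
respects? e B c = Fin.all? λ k → (k ∈? B) →-dec (c (proj₁ (e k)) Fin.≟ c (proj₂ (e k)))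

_≗?_ : ∀ {m p} (f g : Fin m → Fin p) → Dec (∀ i → f i ≡ g i)
f ≗? g = Fin.all? λ i → f i Fin.≟ g i

-- A colouring satisfies the equations of an intersection of diagonals iff the
-- real indicator vectors of its colour classes lie in the intersection.
module Indicator {n p} (c : Fin n → Fin p) (s : Fin p) where

  open CommutativeRing ℝ-ring using (_≈_; sym; reflexive; trans)

  𝟙 : Fin n → ℝ
  𝟙 i = Real.fromℚ (if does (s Fin.≟ c i) then 1ℚ else 0ℚ)

  𝟙≈⇒≡ : ∀ {i j} → 𝟙 i ≈ 𝟙 j → c i ≡ s → s ≡ c j
  𝟙≈⇒≡ {i} {j} e ≡.refl with c i Fin.≟ c i | c i Fin.≟ c j
  ... | no ¬r | _     = contradiction ≡.refl ¬r
  ... | yes _ | yes r = r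
  ... | yes _ | no _ with e ½ (ℚ.positive⁻¹ ½)
  -- Both indicators are constant sequences, here 1 and 0. Equality of their limits, tested with
  -- tolerance ½, would put 1 below ½.
  ...   | N , h = contradiction (h N ℕ.≤-refl) (from-no (ℚ.∣ 1ℚ ℚ.- 0ℚ ∣ ℚ.<? ½))

  ≡⇒𝟙≈ : ∀ {i j} → c i ≡ c j → 𝟙 i ≈ 𝟙 j
  ≡⇒𝟙≈ r = reflexive (≡.cong (λ k → Real.fromℚ (if does (s Fin.≟ k) then 1ℚ else 0ℚ)) r)

-- d is, definitionally, the dimension from which Arrangement.rank is computed for 𝒜 I.
module Blocks {n m} (e : Fin m → Fin n × Fin n) (B : Subset m) where

  open Labelling (labelling e B) public
  open CommutativeRing ℝ-ring using (+-group)
  open import Algebra.Properties.Group +-group using (x∙y⁻¹≈ε⇒x≈y; x≈y⇒x∙y⁻¹≈ε)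

  -- The labelling knows only about real vectors. It is tested on the indicator of the colour class
  -- of `c i`; the converse likewise tests the class of an endpoint of each edge.
  respects⇒constant : ∀ {p} (c : Fin n → Fin p) → Respects e B c → ∀ i j → label i ≡ label j → c i ≡ c j
  respects⇒constant c h i j l = 𝟙≈⇒≡ {i} {j} (to 𝟙 inside-⋂ i j l) ≡.refl
    where
    open Indicator c (c i)
    inside-⋂ : ⋂ (diagonal ∘ e) B 𝟙
    inside-⋂ k k∈B = x≈y⇒x∙y⁻¹≈ε {𝟙 (proj₁ (e k))} {𝟙 (proj₂ (e k))}
      (≡⇒𝟙≈ {proj₁ (e k)} {proj₂ (e k)} (h k k∈B))

  constant⇒respects : ∀ {p} (c : Fin n → Fin p) → (∀ i j → label i ≡ label j → c i ≡ c j) → Respects e B c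
  constant⇒respects c h k k∈B = 𝟙≈⇒≡ {proj₁ (e k)} {proj₂ (e k)}
    (x∙y⁻¹≈ε⇒x≈y (𝟙 (proj₁ (e k))) (𝟙 (proj₂ (e k)))
      (from 𝟙 (λ i j l → ≡⇒𝟙≈ {i} {j} (h i j l)) k k∈B)) ≡.refl
    where open Indicator c (c (proj₁ (e k)))

  d≤n : d ≤ n
  d≤n = Fin.injective⇒≤ {f = repr} λ {k} {l} r →
    ≡.trans (≡.sym (label-repr k)) (≡.trans (≡.cong label r) (label-repr l))

  d≥1 : 1 ≤ n → 1 ≤ d
  d≥1 (s≤s _) = ℕ.≤-trans (s≤s z≤n) (Fin.toℕ<n (label zero))

  label-edge : ∀ k → k ∈ B → label (proj₁ (e k)) ≡ label (proj₂ (e k))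
  label-edge = constant⇒respects label λ _ _ → id

  connected⇒d≡1 : ∀ i → (∀ j → label j ≡ label i) → d ≡ 1
  connected⇒d≡1 i h = ℕ.≤-antisym
    (Fin.injective⇒≤ {f = λ (_ : Fin d) → zero {n = 0}} λ {k} {l} _ → ≡.trans (all k) (≡.sym (all l)))
    (ℕ.≤-trans (s≤s z≤n) (Fin.toℕ<n (label i)))
    where
    all : ∀ k → k ≡ label i
    all k = ≡.trans (≡.sym (label-repr k)) (h (repr k))

-- One equation identifies at most two labels. The case split follows the one inside `merge`, so
-- each case computes.
merge-d : ∀ {n} {W : Pred (F.Vector ℝ n) 0ℓ} i j (L : Labelling W) →
          Labelling.d L ≤ suc (Labelling.d (merge i j L))
merge-d i j record { d = zero } = z≤n
merge-d i j record { d = suc d ; label = label } with label j Fin.≟ label i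
... | yes _ = ℕ.n≤1+n (suc d)
... | no  _ = ℕ.≤-refl

-- This is the bound of the rank by the number of hyperplanes, which makes the second truncated
-- exponent of the Tutte polynomial exact.
n≤d+∣B∣ : ∀ {n m} (e : Fin m → Fin n × Fin n) (B : Subset m) → n ≤ Labelling.d (labelling e B) ℕ.+ ∣ B ∣
n≤d+∣B∣ e []            = ℕ.≤-reflexive (≡.sym (ℕ.+-identityʳ _))
n≤d+∣B∣ e (outside ∷ B) = n≤d+∣B∣ (e ∘ suc) B
n≤d+∣B∣ e (inside ∷ B)  = ℕ.≤-trans (n≤d+∣B∣ (e ∘ suc) B)
  (ℕ.≤-trans (ℕ.+-monoˡ-≤ ∣ B ∣ (merge-d (proj₁ (e zero)) (proj₂ (e zero)) (labelling (e ∘ suc) B)))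
             (ℕ.≤-reflexive (≡.sym (ℕ.+-suc _ ∣ B ∣))))

-- Colourings respecting a set of edges, and sums over sets of edges

module SubsetSums {c ℓ} (R : CommutativeSemiring c ℓ) where

  open CommutativeSemiring R hiding (zero)
  open SemiringSums R
  open SetoidReasoning setoid

  -- The list `colourings m p` contains each function once up to pointwise equality. This is the
  -- unit that replaces reindexing along a bijection.
  ∑-[≗] : ∀ {m p} (g : Fin m → Fin p) → ∑ (colourings m p) (λ f → [ f ≗? g ]) ≈ 1#
  ∑-[≗] {m} {p} g = trans (∑-choices-∀ m (λ _ → allFin p) λ i s → s Fin.≟ g i)
    (trans (∏-cong (allFin m) λ i → trans
        (∑-cong (allFin p) λ s → []-cong (s Fin.≟ g i) (g i Fin.≟ s) ≡.sym ≡.sym) (∑-[≟] (g i)))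
      (∏-1 (allFin m)))

  module _ {n m} (e : Fin m → Fin n × Fin n) (B : Subset m) where

    open Blocks e B

    -- Double counting of pairs `c`, `f` with `c` equal to `f ∘ label`: a respecting colouring
    -- determines `f` through `repr`, and each `f` determines its `c`. The number of colours appears
    -- as a sum of ones because the semiring is arbitrary.
    count-respecting : ∀ p → ∑ (colourings n p) (λ c → [ respects? e B c ]) ≈ ∑ (allFin p) (λ _ → 1#) ^ d
    count-respecting p = begin
      ∑ (colourings n p) (λ c → [ respects? e B c ])
        ≈⟨ ∑-cong (colourings n p) (λ c → sym (trans
             (∑-*ʳ [ respects? e B c ] (colourings d p) λ f → [ f ≗? (c ∘ repr) ])
             (trans (*-congʳ (∑-[≗] (c ∘ repr))) (*-identityˡ _)))) ⟩
      ∑ (colourings n p) (λ c → ∑ (colourings d p) λ f → [ f ≗? (c ∘ repr) ] * [ respects? e B c ])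
        ≈⟨ ∑-cong (colourings n p) (λ c → ∑-cong (colourings d p) (factors c)) ⟩
      ∑ (colourings n p) (λ c → ∑ (colourings d p) λ f → [ c ≗? (f ∘ label) ])
        ≈⟨ ∑-swap (colourings n p) (colourings d p) _ ⟩
      ∑ (colourings d p) (λ f → ∑ (colourings n p) λ c → [ c ≗? (f ∘ label) ])
        ≈⟨ ∑-cong (colourings d p) (λ f → ∑-[≗] (f ∘ label)) ⟩
      ∑ (colourings d p) (λ _ → 1#)
        ≈⟨ ∑-choices-1 d (allFin p) ⟩
      ∑ (allFin p) (λ _ → 1#) ^ d ∎
      where
      factors : ∀ c f → [ f ≗? (c ∘ repr) ] * [ respects? e B c ] ≈ [ c ≗? (f ∘ label) ]
      factors c f = trans (sym ([]-× (f ≗? (c ∘ repr)) (respects? e B c)))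
        ([]-cong ((f ≗? (c ∘ repr)) ×-dec respects? e B c) (c ≗? (f ∘ label))
          (λ { (h , k) i → ≡.trans
            (respects⇒constant c k i (repr (label i)) (≡.sym (label-repr (label i)))) (≡.sym (h (label i))) })
          (λ h → (λ k → ≡.sym (≡.trans (h (repr k)) (≡.cong f (label-repr k))))
               , constant⇒respects c λ i j l → ≡.trans (h i) (≡.trans (≡.cong f l) (≡.sym (h j)))))

  -- Expansion of the product: choosing the second summand in the factors indexed by `B` gives
  -- `z ^ ∣ B ∣`, and the brackets discard every `B` with an element outside `Q`.
  ∑-allSubsets : ∀ m {Q : Fin m → Set} (Q? : Decidable Q) z →
    ∑ (allSubsets m) (λ B → [ Fin.all? (λ k → (k ∈? B) →-dec Q? k) ] * z ^ ∣ B ∣) ≈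
    ∏ (allFin m) (λ k → 1# + [ Q? k ] * z)
  ∑-allSubsets zero    Q? z = trans (+-identityʳ _) (trans (*-identityʳ _)
    ([]-true (Fin.all? λ k → (k ∈? []) →-dec Q? k) λ ()))
  ∑-allSubsets (suc m) {Q} Q? z = begin
    ∑ (allSubsets (suc m)) (weight Q?)
      ≈⟨ ∑-++ (map (outside ∷_) (allSubsets m)) _ (weight Q?) ⟩
    ∑ (map (outside ∷_) (allSubsets m)) (weight Q?) + ∑ (map (inside ∷_) (allSubsets m)) (weight Q?)
      ≡⟨ ≡.cong₂ _+_ (∑-map (outside ∷_) (allSubsets m) (weight Q?)) (∑-map (inside ∷_) (allSubsets m) (weight Q?)) ⟩
    ∑ (allSubsets m) (weight Q? ∘ (outside ∷_)) + ∑ (allSubsets m) (weight Q? ∘ (inside ∷_))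
      ≈⟨ +-cong (∑-cong (allSubsets m) without) (trans (∑-cong (allSubsets m) with₀) (∑-*ˡ ([ Q? zero ] * z) (allSubsets m) _)) ⟩
    S + ([ Q? zero ] * z) * S
      ≈⟨ trans (+-congʳ (sym (*-identityˡ S))) (sym (distribʳ S 1# _)) ⟩
    (1# + [ Q? zero ] * z) * S
      ≈⟨ *-congˡ (∑-allSubsets m (Q? ∘ suc) z) ⟩
    (1# + [ Q? zero ] * z) * ∏ (allFin m) (λ k → 1# + [ Q? (suc k) ] * z)
      ≡⟨ ≡.sym (∏-suc {m} λ k → 1# + [ Q? k ] * z) ⟩
    ∏ (allFin (suc m)) (λ k → 1# + [ Q? k ] * z) ∎
    where
    holds? : ∀ {m} {Q : Fin m → Set} (Q? : Decidable Q) (B : Subset m) → Dec (∀ k → k ∈ B → Q k)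
    holds? Q? B = Fin.all? λ k → (k ∈? B) →-dec Q? k
    weight : ∀ {m} {Q : Fin m → Set} → Decidable Q → Subset m → Carrier
    weight Q? B = [ holds? Q? B ] * z ^ ∣ B ∣
    S : Carrier
    S = ∑ (allSubsets m) (weight (Q? ∘ suc))
    without : ∀ B → weight Q? (outside ∷ B) ≈ weight (Q? ∘ suc) B
    without B = *-congʳ ([]-cong (holds? Q? (outside ∷ B)) (holds? (Q? ∘ suc) B)
      (λ h k k∈ → h (suc k) (Vec.there k∈)) λ { h (suc k) (Vec.there k∈) → h k k∈ })
    with₀ : ∀ B → weight Q? (inside ∷ B) ≈ ([ Q? zero ] * z) * weight (Q? ∘ suc) B
    with₀ B = begin
      [ holds? Q? (inside ∷ B) ] * (z * z ^ ∣ B ∣)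
        ≈⟨ *-congʳ ([]-cong (holds? Q? (inside ∷ B)) (Q? zero ×-dec holds? (Q? ∘ suc) B)
             (λ h → h zero Vec.here , λ k k∈ → h (suc k) (Vec.there k∈))
             λ { (h , _) zero Vec.here → h ; (_ , h) (suc k) (Vec.there k∈) → h k k∈ }) ⟩
      [ Q? zero ×-dec holds? (Q? ∘ suc) B ] * (z * z ^ ∣ B ∣)
        ≈⟨ *-congʳ ([]-× (Q? zero) (holds? (Q? ∘ suc) B)) ⟩
      ([ Q? zero ] * [ holds? (Q? ∘ suc) B ]) * (z * z ^ ∣ B ∣)
        ≈⟨ interchange _ _ _ _ ⟩
      ([ Q? zero ] * z) * weight (Q? ∘ suc) B ∎
      where open import Algebra.Properties.CommutativeSemigroup *-commutativeSemigroup using (interchange)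

-- Signatures and blocks

module SignatureBlocks where

  open import Relation.Binary.PropositionalEquality using (refl; sym; trans; module ≡-Reasoning)
  open import Data.Nat.Base using (_+_; _*_)

  ∣∣≡∑ : ∀ {n} (S : Subset n) → ∣ S ∣ ≡ ℕΣ.∑ (allFin n) λ i → ℕΣ.[ i ∈? S ]
  ∣∣≡∑ []      = refl
  ∣∣≡∑ (x ∷ S) = trans (head x) (sym (ℕΣ.∑-suc λ i → ℕΣ.[ i ∈? (x ∷ S) ]))
    where
    tail : ∣ S ∣ ≡ ℕΣ.∑ (allFin _) λ i → ℕΣ.[ suc i ∈? (x ∷ S) ]
    tail = trans (∣∣≡∑ S) (ℕΣ.∑-cong (allFin _) λ i →
      ℕΣ.[]-cong (i ∈? S) (suc i ∈? (x ∷ S)) Vec.there λ { (Vec.there p) → p })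
    head : ∀ y → ∣ y ∷ S ∣ ≡ ℕΣ.[ zero ∈? (y ∷ S) ] + ℕΣ.∑ (allFin _) λ i → ℕΣ.[ suc i ∈? (x ∷ S) ]
    head inside  = cong suc tail
    head outside = tail

  module BlockOf {n} {X : Set} (_≟X_ : (a b : X) → Dec (a ≡ b)) (s : Fin n → X) (P : PartitionBy s) where

    open PartitionBy P
    open PartitionConstruction _≟X_ s using (fibre; ∈-fibre⁺; ∈-fibre⁻; fibre-maximal)

    blockOf : Fin n → Fin r
    blockOf i = proj₁ (exhaustive (fibre i) (fibre-maximal i))

    block-blockOf : ∀ i → block (blockOf i) ≡ fibre i
    block-blockOf i = proj₂ (exhaustive (fibre i) (fibre-maximal i))

    ∈-blockOf : ∀ i → i ∈ block (blockOf i)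
    ∈-blockOf i = subst (i ∈_) (sym (block-blockOf i)) (∈-fibre⁺ refl)

    min-injective : ∀ u v → min u ≡ min v → u ≡ v
    min-injective u v e with Fin.<-cmp u v
    ... | tri< u<v _ _ = contradiction (cong toℕ e) (ℕ.<⇒≢ (increasing u<v))
    ... | tri≈ _ u≡v _ = u≡v
    ... | tri> _ _ v<u = contradiction (cong toℕ (sym e)) (ℕ.<⇒≢ (increasing v<u))

    -- A block determines its minimum, and the minima are strictly increasing in the index.
    block-injective : ∀ u v → block u ≡ block v → u ≡ v
    block-injective u v e = min-injective u v (Fin.≤-antisym
      (proj₂ (isMinimum u) (subst (min v ∈_) (sym e) (proj₁ (isMinimum v))))
      (proj₂ (isMinimum v) (subst (min u ∈_) e (proj₁ (isMinimum u)))))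

    ∈-block⇒≡ : ∀ {i u} → i ∈ block u → blockOf i ≡ u
    ∈-block⇒≡ {i} {u} i∈ = block-injective (blockOf i) u
      (trans (block-blockOf i) (⊆-antisym fibre⊆ ⊆fibre))
      where
      ⊆fibre : block u ⊆ fibre i
      ⊆fibre j∈ = ∈-fibre⁺ (proj₁ (proj₂ (isMaximal u)) j∈ i∈)
      fibre⊆ : fibre i ⊆ block u
      fibre⊆ = proj₂ (proj₂ (isMaximal u)) (fibre i) ⊆fibre λ p q → trans (∈-fibre⁻ p) (sym (∈-fibre⁻ q))

    ∣block∣ : ∀ u → ∣ block u ∣ ≡ fibreSize blockOf u
    ∣block∣ u = trans (∣∣≡∑ (block u)) (ℕΣ.∑-cong (allFin n) λ i →
      ℕΣ.[]-cong (i ∈? block u) (blockOf i Fin.≟ u) ∈-block⇒≡ λ { refl → ∈-blockOf i })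

    s-min : ∀ i → s (min (blockOf i)) ≡ s i
    s-min i = proj₁ (proj₂ (isMaximal (blockOf i))) (proj₁ (isMinimum (blockOf i))) (∈-blockOf i)

  module Signatures {n} (I : Ideal n) where

    maximalRoot : Fin (List.length (maximalRoots I)) → Root n
    maximalRoot = lookup (maximalRoots I)

    maximalRoot-maximal : ∀ l → Maximal I (maximalRoot l)
    maximalRoot-maximal l = proj₂ (∈-filter⁻ (maximal? I) {xs = allRoots n} (∈-lookup {xs = maximalRoots I} l))

    Contains : Root n → Fin n → Set
    Contains α u = lo α Fin.≤ u × u Fin.≤ hi α

    contains? : ∀ α u → Dec (Contains α u)
    contains? α u = lo α Fin.≤? u ×-dec u Fin.≤? hi α

    ∈-signature⁺ : ∀ {l u} → Contains (maximalRoot l) u → l ∈ signature I u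
    ∈-signature⁺ {l} {u} p = Vec.lookup⇒[]= l (signature I u)
      (trans (Vec.lookup∘tabulate _ l) (dec-true (contains? (maximalRoot l) u) p))

    ∈-signature⁻ : ∀ {l u} → l ∈ signature I u → Contains (maximalRoot l) u
    ∈-signature⁻ {l} {u} h with contains? (maximalRoot l) u in eq
    ... | yes p = p
    ... | no  _ = case trans (sym (Vec.[]=⇒lookup h)) (trans (Vec.lookup∘tabulate _ l) (cong does eq)) of λ ()

    Larger : Root n → Root n → Set
    Larger β γ = ¬ mem I γ × (lo γ Fin.≤ lo β × hi β Fin.≤ hi γ) × γ ≢ β

    larger? : ∀ β γ → Dec (Larger β γ)
    larger? β γ = ¬? (mem? I γ) ×-dec ((lo γ Fin.≤? lo β ×-dec hi β Fin.≤? hi γ) ×-dec ¬? (γ ≟-root β))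

    -- A termination measure for climbing to a maximal root: both summands weakly decrease when the
    -- interval grows, and one does so strictly when the root changes.
    codepth : Root n → ℕ
    codepth β = (n ∸ toℕ (hi β)) + toℕ (lo β)

    codepth-larger : ∀ {β γ} → Larger β γ → codepth γ < codepth β
    codepth-larger {root i j p} {root k l q} (_ , (k≤i , j≤l) , γ≢β) with k Fin.≟ i | j Fin.≟ l
    ... | yes refl | yes refl = contradiction (cong (root i j) (ℕ.<-irrelevant q p)) γ≢β
    ... | yes refl | no j≢l   = ℕ.+-monoˡ-< (toℕ i)
      (ℕ.∸-monoʳ-< (Fin.≤∧≢⇒< j≤l j≢l) (ℕ.<⇒≤ (Fin.toℕ<n l)))
    ... | no k≢i   | _        = ℕ.+-mono-≤-< (ℕ.∸-monoʳ-≤ n j≤l) (Fin.≤∧≢⇒< k≤i k≢i)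

    -- N bounds the recursion: every strictly larger root has smaller codepth.
    maximal-above : ∀ N β → codepth β < N → ¬ mem I β → ∃ λ α → Maximal I α × β ≼ α
    maximal-above (suc N) β (s≤s d≤N) β∉I with Any.any? (larger? β) (allRoots n)
    ... | no none = β , (β∉I , λ γ γ∉I β≼γ → decidable-stable (γ ≟-root β)
          λ γ≢β → none (List.lose (∈-allRoots γ) (γ∉I , β≼γ , γ≢β))) , ℕ.≤-refl , ℕ.≤-refl
    ... | yes some with Any.satisfied some
    ...   | γ , larger@(γ∉I , (lo≤ , hi≤) , _) with maximal-above N γ (ℕ.<-≤-trans (codepth-larger larger) d≤N) γ∉I
    ...     | α , max , lo≤′ , hi≤′ = α , max , ℕ.≤-trans lo≤′ lo≤ , ℕ.≤-trans hi≤ hi≤′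

    containing-maximal : ∀ α → Maximal I α → ∃ λ l → ∀ u → Contains α u → l ∈ signature I u
    containing-maximal α max = index (∈-filter⁺ (maximal? I) (∈-allRoots α) max)
      where
      index : α List.∈ maximalRoots I → ∃ λ l → ∀ u → Contains α u → l ∈ signature I u
      index α∈ = Any.index α∈ , λ u c →
        ∈-signature⁺ {Any.index α∈} {u} (subst (λ γ → Contains γ u) (Any.lookup-index α∈) c)

    -- Some maximal root outside `I` lies above `β`; its interval contains that of `β`, so its index
    -- belongs to the signature of every vertex of `β`.
    common-index : ∀ β → ¬ mem I β → ∃ λ l → ∀ u → Contains β u → l ∈ signature I u
    common-index β β∉I = go (maximal-above (suc (codepth β)) β ℕ.≤-refl β∉I)
      where
      go : (∃ λ α → Maximal I α × β ≼ α) → ∃ λ l → ∀ u → Contains β u → l ∈ signature I u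
      go (α , max , lo≤ , hi≤) = proj₁ l , λ u (lo≤u , u≤hi) →
        proj₂ l u (ℕ.≤-trans lo≤ lo≤u , ℕ.≤-trans u≤hi hi≤)
        where
        l : ∃ λ l → ∀ u → Contains α u → l ∈ signature I u
        l = containing-maximal α max

    Adjacent : Fin n → Fin n → Set
    Adjacent i j = Nonempty (signature I i ∩ signature I j)

    adjacent? : ∀ i j → Dec (Adjacent i j)
    adjacent? i j = nonempty? (signature I i ∩ signature I j)

    adjacent-sym : ∀ {i j} → Adjacent i j → Adjacent j i
    adjacent-sym {i} {j} = subst Nonempty (∩-comm (signature I i) (signature I j))

    contained-adjacent : ∀ α → ¬ mem I α → ∀ u v → Contains α u → Contains α v → Adjacent u v
    contained-adjacent α α∉I u v p q = proj₁ l , x∈p∩q⁺ (proj₂ l u p , proj₂ l v q)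
      where
      l : ∃ λ l → ∀ u → Contains α u → l ∈ signature I u
      l = common-index α α∉I

    ∉⇒adjacent : ∀ α → ¬ mem I α → Adjacent (lo α) (hi α)
    ∉⇒adjacent α α∉I = contained-adjacent α α∉I (lo α) (hi α)
      (ℕ.≤-refl , ℕ.<⇒≤ (lo<hi α)) (ℕ.<⇒≤ (lo<hi α) , ℕ.≤-refl)

    -- A common index names a maximal root of the complement whose interval contains both ends of
    -- `α`. If `α` were in `I`, up-closure would put that root in `I` too.
    adjacent⇒∉ : ∀ α → Adjacent (lo α) (hi α) → ¬ mem I α
    adjacent⇒∉ α (l , l∈) α∈I = proj₁ (maximalRoot-maximal l)
      (upClosed I (proj₁ (∈-signature⁻ (proj₁ l∈²)) , proj₂ (∈-signature⁻ (proj₂ l∈²))) α∈I)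
      where
      l∈² : l ∈ signature I (lo α) × l ∈ signature I (hi α)
      l∈² = x∈p∩q⁻ (signature I (lo α)) (signature I (hi α)) l∈

  -- Every vertex lies in a simple root.
  adjacent-refl : ∀ {n} (I : Ideal n) → 2 ≤ n → Full I → ∀ i → Signatures.Adjacent I i i
  adjacent-refl {suc (suc n)} I (s≤s (s≤s _)) full zero =
    Signatures.contained-adjacent I (root zero (suc zero) (s≤s z≤n)) (full _ refl) zero zero (z≤n , z≤n) (z≤n , z≤n)
  adjacent-refl {suc (suc n)} I (s≤s (s≤s _)) full (suc i) =
    Signatures.contained-adjacent I α (full α (cong suc (sym (Fin.toℕ-inject₁ i)))) (suc i) (suc i) in-α in-α
    where
    α : Root (suc (suc n))
    α = root (Fin.inject₁ i) (suc i) (s≤s (ℕ.≤-reflexive (Fin.toℕ-inject₁ i)))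
    in-α : lo α Fin.≤ suc i × suc i Fin.≤ hi α
    in-α = ℕ.≤-trans (ℕ.≤-reflexive (Fin.toℕ-inject₁ i)) (ℕ.n≤1+n _) , ℕ.≤-refl

open SignatureBlocks

-- Monochromatic edges

module MonochromaticEdges where

  open import Relation.Binary.PropositionalEquality using (refl; sym; trans; module ≡-Reasoning)
  open import Data.Nat.Base using (_+_; _*_)
  open ≡-Reasoning
  open ℕΣ

  -- Doubling removes the binomial coefficient and supplies the diagonal terms, squares of profile
  -- entries, of a symmetric double sum.
  2*C2 : ∀ m → 2 * (m C 2) + m ≡ m * m
  2*C2 zero    = refl
  2*C2 (suc m) = begin
    2 * (suc m C 2) + suc m
      ≡⟨ cong (λ k → 2 * k + suc m) (trans (sym (nCk+nC[k+1]≡[n+1]C[k+1] m 1)) (cong (_+ (m C 2)) (nC1≡n m))) ⟩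
    2 * (m + (m C 2)) + suc m
      ≡⟨ solve 2 (λ m k → con 2 :* (m :+ k) :+ (con 1 :+ m) := (con 2 :* k :+ m) :+ (con 1 :+ con 2 :* m)) refl m (m C 2) ⟩
    (2 * (m C 2) + m) + (1 + 2 * m)
      ≡⟨ cong (_+ (1 + 2 * m)) (2*C2 m) ⟩
    m * m + (1 + 2 * m)
      ≡⟨ solve 1 (λ m → m :* m :+ (con 1 :+ con 2 :* m) := (con 1 :+ m) :* (con 1 :+ m)) refl m ⟩
    suc m * suc m ∎
    where open +-*-Solver

  -- Trichotomy cuts the square into its diagonal and two triangles, which symmetry and an exchange
  -- of summations identify.
  ∑-symmetric : ∀ {m} (g : Fin m → Fin m → ℕ) → (∀ i j → g i j ≡ g j i) →
    ∑ (allFin m) (λ i → ∑ (allFin m) (g i)) ≡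
    ∑ (allFin m) (λ i → g i i) + 2 * ∑ (allFin m) (λ i → ∑ (allFin m) λ j → [ i Fin.<? j ] * g i j)
  ∑-symmetric {m} g g-sym = begin
    ∑ F (λ i → ∑ F (g i))
      ≡⟨ ∑-cong F (λ i → trans (∑-cong F (split i)) (trans (∑-+ F _ _) (cong₂ _+_ (∑-pick i (g i)) (∑-+ F _ _)))) ⟩
    ∑ F (λ i → g i i + (∑ F (λ j → [ i Fin.<? j ] * g i j) + ∑ F (λ j → [ j Fin.<? i ] * g i j)))
      ≡⟨ trans (∑-+ F (λ i → g i i) _) (cong (_+_ (∑ F (λ i → g i i))) (∑-+ F (λ i → ∑ F λ j → [ i Fin.<? j ] * g i j) _)) ⟩
    ∑ F (λ i → g i i) + (T + ∑ F (λ i → ∑ F λ j → [ j Fin.<? i ] * g i j))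
      ≡⟨ cong (λ x → ∑ F (λ i → g i i) + (T + x)) (trans (∑-swap F F (λ i j → [ j Fin.<? i ] * g i j))
           (∑-cong F λ j → ∑-cong F λ i → cong ([ j Fin.<? i ] *_) (g-sym i j))) ⟩
    ∑ F (λ i → g i i) + (T + T)
      ≡⟨ cong (λ x → ∑ F (λ i → g i i) + (T + x)) (sym (ℕ.+-identityʳ T)) ⟩
    ∑ F (λ i → g i i) + 2 * T ∎
    where
    F : List (Fin m)
    F = allFin m
    T : ℕ
    T = ∑ F (λ i → ∑ F λ j → [ i Fin.<? j ] * g i j)
    split : ∀ i j → g i j ≡ [ i Fin.≟ j ] * g i j + ([ i Fin.<? j ] * g i j + [ j Fin.<? i ] * g i j)
    split i j with Fin.<-cmp i j
    ... | tri< p q r rewrite []-false (i Fin.≟ j) q | []-true (i Fin.<? j) p | []-false (j Fin.<? i) r =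
      solve 1 (λ x → x := con 1 :* x :+ con 0) refl (g i j)
      where open +-*-Solver
    ... | tri≈ p q r rewrite []-true (i Fin.≟ j) q | []-false (i Fin.<? j) p | []-false (j Fin.<? i) r =
      solve 1 (λ x → x := con 1 :* x :+ con 0) refl (g i j)
      where open +-*-Solver
    ... | tri> p q r rewrite []-false (i Fin.≟ j) q | []-false (i Fin.<? j) p | []-true (j Fin.<? i) r =
      solve 1 (λ x → x := con 1 :* x) refl (g i j)
      where open +-*-Solver

  module _ {n r p} (b : Fin n → Fin r) (c : Fin n → Fin p) where

    ∑-profile : ∀ s (f : Fin r → ℕ) →
                ∑ (allFin r) (λ u → profile b c u s * f u) ≡ ∑ (allFin n) (λ i → [ c i Fin.≟ s ] * f (b i))
    ∑-profile s f = begin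
      ∑ (allFin r) (λ u → profile b c u s * f u)
        ≡⟨ ∑-cong (allFin r) (λ u → sym (∑-*ʳ (f u) (allFin n) _)) ⟩
      ∑ (allFin r) (λ u → ∑ (allFin n) λ i → ([ b i Fin.≟ u ] * [ c i Fin.≟ s ]) * f u)
        ≡⟨ ∑-swap (allFin r) (allFin n) (λ u i → ([ b i Fin.≟ u ] * [ c i Fin.≟ s ]) * f u) ⟩
      ∑ (allFin n) (λ i → ∑ (allFin r) λ u → ([ b i Fin.≟ u ] * [ c i Fin.≟ s ]) * f u)
        ≡⟨ ∑-cong (allFin n) (λ i → trans
             (∑-cong (allFin r) λ u → ℕ.*-assoc [ b i Fin.≟ u ] [ c i Fin.≟ s ] (f u))
             (∑-pick (b i) λ u → [ c i Fin.≟ s ] * f u)) ⟩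
      ∑ (allFin n) (λ i → [ c i Fin.≟ s ] * f (b i)) ∎

    -- Each product of profile entries counts ordered pairs of vertices, one in each block, sharing
    -- the colour `s`; summing over `s` leaves all pairs of equal colour. This links sums over
    -- blocks to sums over vertices.
    ∑-profile-pairs : ∀ (h : Fin r → Fin r → ℕ) →
      ∑ (allFin p) (λ s → ∑ (allFin r) λ u → ∑ (allFin r) λ v → h u v * (profile b c u s * profile b c v s)) ≡
      ∑ (allFin n) (λ i → ∑ (allFin n) λ j → [ c i Fin.≟ c j ] * h (b i) (b j))
    ∑-profile-pairs h = begin
      ∑ (allFin p) (λ s → ∑ (allFin r) λ u → ∑ (allFin r) λ v → h u v * (profile b c u s * profile b c v s))
        ≡⟨ ∑-cong (allFin p) (λ s → trans (∑-cong (allFin r) λ u → inner s u) (∑-profile s _)) ⟩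
      ∑ (allFin p) (λ s → ∑ (allFin n) λ i → [ c i Fin.≟ s ] * ∑ (allFin n) (λ j → [ c j Fin.≟ s ] * h (b i) (b j)))
        ≡⟨ ∑-swap (allFin p) (allFin n) (λ s i → [ c i Fin.≟ s ] * ∑ (allFin n) (λ j → [ c j Fin.≟ s ] * h (b i) (b j))) ⟩
      ∑ (allFin n) (λ i → ∑ (allFin p) λ s → [ c i Fin.≟ s ] * ∑ (allFin n) (λ j → [ c j Fin.≟ s ] * h (b i) (b j)))
        ≡⟨ ∑-cong (allFin n) (λ i → trans (∑-pick (c i) λ s → ∑ (allFin n) (λ j → [ c j Fin.≟ s ] * h (b i) (b j)))
             (∑-cong (allFin n) λ j → cong (_* h (b i) (b j)) ([]-cong (c j Fin.≟ c i) (c i Fin.≟ c j) sym sym))) ⟩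
      ∑ (allFin n) (λ i → ∑ (allFin n) λ j → [ c i Fin.≟ c j ] * h (b i) (b j)) ∎
      where
      inner : ∀ s u → ∑ (allFin r) (λ v → h u v * (profile b c u s * profile b c v s)) ≡
                      profile b c u s * ∑ (allFin n) (λ j → [ c j Fin.≟ s ] * h u (b j))
      inner s u = begin
        ∑ (allFin r) (λ v → h u v * (profile b c u s * profile b c v s))
          ≡⟨ ∑-cong (allFin r) (λ v → rearrange (h u v) (profile b c u s) (profile b c v s)) ⟩
        ∑ (allFin r) (λ v → profile b c u s * (profile b c v s * h u v))
          ≡⟨ ∑-*ˡ (profile b c u s) (allFin r) _ ⟩
        profile b c u s * ∑ (allFin r) (λ v → profile b c v s * h u v)
          ≡⟨ cong (profile b c u s *_) (∑-profile s (h u)) ⟩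
        profile b c u s * ∑ (allFin n) (λ j → [ c j Fin.≟ s ] * h u (b j)) ∎
        where
        open +-*-Solver
        rearrange : ∀ x y z → x * (y * z) ≡ y * (z * x)
        rearrange = solve 3 (λ x y z → x :* (y :* z) := y :* (z :* x)) refl

    ∑∑-profile : ∑ (allFin p) (λ s → ∑ (allFin r) λ u → profile b c u s) ≡ ∑ (allFin n) (λ _ → 1)
    ∑∑-profile = begin
      ∑ (allFin p) (λ s → ∑ (allFin r) λ u → profile b c u s)
        ≡⟨ ∑-cong (allFin p) (λ s → trans (∑-cong (allFin r) λ u → sym (ℕ.*-identityʳ _)) (∑-profile s λ _ → 1)) ⟩
      ∑ (allFin p) (λ s → ∑ (allFin n) λ i → [ c i Fin.≟ s ] * 1)
        ≡⟨ ∑-swap (allFin p) (allFin n) (λ s i → [ c i Fin.≟ s ] * 1) ⟩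
      ∑ (allFin n) (λ i → ∑ (allFin p) λ s → [ c i Fin.≟ s ] * 1)
        ≡⟨ ∑-cong (allFin n) (λ i → ∑-pick (c i) λ _ → 1) ⟩
      ∑ (allFin n) (λ _ → 1) ∎

  rootsAt-< : ∀ {n} (i j : Fin n) (q : i Fin.< j) → rootsAt i j ≡ root i j q List.∷ List.[]
  rootsAt-< i j q with i Fin.<? j
  ... | yes q′ = cong (λ q → root i j q List.∷ List.[]) (ℕ.<-irrelevant q′ q)
  ... | no i≮j = contradiction q i≮j

  rootsAt-≮ : ∀ {n} (i j : Fin n) → ¬ i Fin.< j → rootsAt i j ≡ List.[]
  rootsAt-≮ i j i≮j with i Fin.<? j
  ... | yes q = contradiction q i≮j
  ... | no _  = refl

  -- Membership in `I` makes sense only for pairs with `i < j`. Trading it for a relation `A` on all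
  -- pairs prepares the sum for `∑-symmetric`.
  ∑-complement : ∀ {n} (I : Ideal n) {A : Fin n → Fin n → Set} (A? : ∀ i j → Dec (A i j)) →
    (∀ α → ¬ mem I α → A (lo α) (hi α)) → (∀ α → A (lo α) (hi α) → ¬ mem I α) →
    (f : Fin n → Fin n → ℕ) →
    ∑ (complement I) (λ α → f (lo α) (hi α)) ≡
    ∑ (allFin n) λ i → ∑ (allFin n) λ j → [ i Fin.<? j ] * ([ A? i j ] * f i j)
  ∑-complement {n} I {A} A? ∉⇒A A⇒∉ f = begin
    ∑ (complement I) f′
      ≡⟨ ∑-filter (λ α → ¬? (mem? I α)) (allRoots n) f′ ⟩
    ∑ (allRoots n) w
      ≡⟨ ∑-concatMap (λ i → concatMap (rootsAt i) (allFin n)) (allFin n) w ⟩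
    ∑ (allFin n) (λ i → ∑ (concatMap (rootsAt i) (allFin n)) w)
      ≡⟨ ∑-cong (allFin n) (λ i → trans (∑-concatMap (rootsAt i) (allFin n) w) (∑-cong (allFin n) (at i))) ⟩
    ∑ (allFin n) (λ i → ∑ (allFin n) λ j → [ i Fin.<? j ] * ([ A? i j ] * f i j)) ∎
    where
    f′ w : Root n → ℕ
    f′ α = f (lo α) (hi α)
    w α = [ ¬? (mem? I α) ] * f′ α
    at : ∀ i j → ∑ (rootsAt i j) w ≡ [ i Fin.<? j ] * ([ A? i j ] * f i j)
    at i j = case i Fin.<? j of λ
      { (no i≮j) → trans (cong (λ αs → ∑ αs w) (rootsAt-≮ i j i≮j))
          (sym (cong (_* ([ A? i j ] * f i j)) ([]-false (i Fin.<? j) i≮j)))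
      ; (yes q)  → trans (cong (λ αs → ∑ αs w) (rootsAt-< i j q))
          (trans (ℕ.+-identityʳ _) (trans
            (cong (_* f i j) ([]-cong (¬? (mem? I (root i j q))) (A? i j) (∉⇒A (root i j q)) (A⇒∉ (root i j q))))
            (sym (trans (cong (_* ([ A? i j ] * f i j)) ([]-true (i Fin.<? j) q)) (ℕ.*-identityˡ _)))))
      }

  module Monochromatic {n} (I : Ideal n) (n≥2 : 2 ≤ n) (full : Full I) (P : Accordance I) where

    open PartitionBy P
    open BlockOf (Vec.≡-dec Bool._≟_) (signature I) P public
    open Signatures I

    blockAdjacent? : ∀ u v → Dec (Nonempty (blockSignature I P u ∩ blockSignature I P v))
    blockAdjacent? u v = nonempty? (blockSignature I P u ∩ blockSignature I P v)

    exponent : ∀ {p} → (Fin r → Fin p → ℕ) → ℕ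
    exponent a = ∑ℕ λ u → ∑ℕ λ s → (a u s C 2) + a u s * sum (map (λ v → a v s) (R I P u))

    exponent-cong : ∀ {p} {a α : Fin r → Fin p → ℕ} → (∀ u s → a u s ≡ α u s) → exponent a ≡ exponent α
    exponent-cong h = cong sum (List.tabulate-cong λ u → cong sum (List.tabulate-cong λ s →
      cong₂ (λ x y → (x C 2) + x * y) (h u s) (cong sum (List.map-cong (λ v → h v s) (R I P u)))))

    monochromatic : ∀ {p} → (Fin n → Fin p) → ℕ
    monochromatic c = ∑ (complement I) λ α → [ c (lo α) Fin.≟ c (hi α) ]

    block-adjacent-refl : ∀ u → Nonempty (blockSignature I P u ∩ blockSignature I P u)
    block-adjacent-refl u = adjacent-refl I n≥2 full (min u)

    -- Doubling turns the sums over u < v into symmetric double sums.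
    2*exponent : ∀ {p} (a : Fin r → Fin p → ℕ) →
      2 * exponent a + ∑ (allFin p) (λ s → ∑ (allFin r) λ u → a u s) ≡
      ∑ (allFin p) (λ s → ∑ (allFin r) λ u → ∑ (allFin r) λ v → [ blockAdjacent? u v ] * (a u s * a v s))
    2*exponent {p} a = begin
      2 * exponent a + ∑ (allFin p) (λ s → ∑ (allFin r) λ u → a u s)
        ≡⟨ cong (_+ ∑ (allFin p) (λ s → ∑ (allFin r) λ u → a u s)) (trans (cong (2 *_) exponent-∑)
             (trans (sym (∑-*ˡ 2 (allFin p) _)) (∑-cong (allFin p) λ s → sym (∑-*ˡ 2 (allFin r) _)))) ⟩
      ∑ (allFin p) (λ s → ∑ (allFin r) λ u → 2 * ((a u s C 2) + a u s * above u s)) + ∑ (allFin p) (λ s → ∑ (allFin r) λ u → a u s)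
        ≡⟨ sym (trans (∑-cong (allFin p) λ s → ∑-+ (allFin r) _ _) (∑-+ (allFin p) _ _)) ⟩
      ∑ (allFin p) (λ s → ∑ (allFin r) λ u → 2 * ((a u s C 2) + a u s * above u s) + a u s)
        ≡⟨ ∑-cong (allFin p) colour ⟩
      ∑ (allFin p) (λ s → ∑ (allFin r) λ u → ∑ (allFin r) (g s u)) ∎
      where
      g : Fin p → Fin r → Fin r → ℕ
      g s u v = [ blockAdjacent? u v ] * (a u s * a v s)
      above : Fin r → Fin p → ℕ
      above u s = ∑ (R I P u) λ v → a v s
      exponent-∑ : exponent a ≡ ∑ (allFin p) (λ s → ∑ (allFin r) λ u → (a u s C 2) + a u s * above u s)
      exponent-∑ = begin
        exponent a
          ≡⟨ trans (∑ℕ≡∑ λ u → ∑ℕ λ s → (a u s C 2) + a u s * sum (map (λ v → a v s) (R I P u)))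
               (∑-cong (allFin r) λ u → ∑ℕ≡∑ λ s → (a u s C 2) + a u s * sum (map (λ v → a v s) (R I P u))) ⟩
        ∑ (allFin r) (λ u → ∑ (allFin p) λ s → (a u s C 2) + a u s * sum (map (λ v → a v s) (R I P u)))
          ≡⟨ ∑-cong (allFin r) (λ u → ∑-cong (allFin p) λ s →
               cong (λ x → (a u s C 2) + a u s * x) (∑-map (λ v → a v s) (R I P u) id)) ⟩
        ∑ (allFin r) (λ u → ∑ (allFin p) λ s → (a u s C 2) + a u s * above u s)
          ≡⟨ ∑-swap (allFin r) (allFin p) _ ⟩
        ∑ (allFin p) (λ s → ∑ (allFin r) λ u → (a u s C 2) + a u s * above u s) ∎
      a*above : ∀ s u → a u s * above u s ≡ ∑ (allFin r) λ v → [ u Fin.<? v ] * g s u v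
      a*above s u = begin
        a u s * above u s
          ≡⟨ cong (a u s *_) (∑-filter (λ v → (u Fin.<? v) ×-dec blockAdjacent? u v) (allFin r) λ v → a v s) ⟩
        a u s * ∑ (allFin r) (λ v → [ (u Fin.<? v) ×-dec blockAdjacent? u v ] * a v s)
          ≡⟨ sym (∑-*ˡ (a u s) (allFin r) _) ⟩
        ∑ (allFin r) (λ v → a u s * ([ (u Fin.<? v) ×-dec blockAdjacent? u v ] * a v s))
          ≡⟨ ∑-cong (allFin r) (λ v → trans
               (cong (λ x → a u s * (x * a v s)) ([]-× (u Fin.<? v) (blockAdjacent? u v)))
               (rearrange (a u s) [ u Fin.<? v ] [ blockAdjacent? u v ] (a v s))) ⟩
        ∑ (allFin r) (λ v → [ u Fin.<? v ] * g s u v) ∎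
        where
        open +-*-Solver
        rearrange : ∀ x y z w → x * ((y * z) * w) ≡ y * (z * (x * w))
        rearrange = solve 4 (λ x y z w → x :* ((y :* z) :* w) := y :* (z :* (x :* w))) refl
      g-sym : ∀ s u v → g s u v ≡ g s v u
      g-sym s u v = cong₂ _*_
        ([]-cong (blockAdjacent? u v) (blockAdjacent? v u) (adjacent-sym {min u} {min v}) (adjacent-sym {min v} {min u}))
        (ℕ.*-comm (a u s) (a v s))
      diagonal-term : ∀ s u → 2 * ((a u s C 2) + a u s * above u s) + a u s ≡
                              g s u u + 2 * ∑ (allFin r) λ v → [ u Fin.<? v ] * g s u v
      diagonal-term s u = begin
        2 * ((a u s C 2) + a u s * above u s) + a u s
          ≡⟨ rearrange (a u s C 2) (a u s * above u s) (a u s) ⟩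
        (2 * (a u s C 2) + a u s) + 2 * (a u s * above u s)
          ≡⟨ cong₂ (λ x y → x + 2 * y)
               (trans (2*C2 (a u s)) (sym (trans (cong (_* (a u s * a u s)) ([]-true (blockAdjacent? u u) (block-adjacent-refl u)))
                 (ℕ.*-identityˡ _))))
               (a*above s u) ⟩
        g s u u + 2 * ∑ (allFin r) (λ v → [ u Fin.<? v ] * g s u v) ∎
        where
        open +-*-Solver
        rearrange : ∀ x y z → 2 * (x + y) + z ≡ (2 * x + z) + 2 * y
        rearrange = solve 3 (λ x y z → con 2 :* (x :+ y) :+ z := (con 2 :* x :+ z) :+ con 2 :* y) refl
      colour : ∀ s → ∑ (allFin r) (λ u → 2 * ((a u s C 2) + a u s * above u s) + a u s) ≡
                     ∑ (allFin r) λ u → ∑ (allFin r) (g s u)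
      colour s = begin
        ∑ (allFin r) (λ u → 2 * ((a u s C 2) + a u s * above u s) + a u s)
          ≡⟨ ∑-cong (allFin r) (diagonal-term s) ⟩
        ∑ (allFin r) (λ u → g s u u + 2 * ∑ (allFin r) λ v → [ u Fin.<? v ] * g s u v)
          ≡⟨ trans (∑-+ (allFin r) _ _) (cong (_+_ (∑ (allFin r) (λ u → g s u u))) (∑-*ˡ 2 (allFin r) _)) ⟩
        ∑ (allFin r) (λ u → g s u u) + 2 * ∑ (allFin r) (λ u → ∑ (allFin r) λ v → [ u Fin.<? v ] * g s u v)
          ≡⟨ sym (∑-symmetric (g s) (g-sym s)) ⟩
        ∑ (allFin r) (λ u → ∑ (allFin r) (g s u)) ∎

    -- Doubled and increased by the number of vertices, both sides count ordered pairs of equally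
    -- coloured vertices whose signatures meet, once by vertices and once by blocks.
    monochromatic≡exponent : ∀ {p} (c : Fin n → Fin p) → monochromatic c ≡ exponent (profile blockOf c)
    monochromatic≡exponent {p} c = ℕ.*-cancelˡ-≡ _ _ 2 (ℕ.+-cancelʳ-≡ N _ _ (begin
      2 * monochromatic c + N
        ≡⟨ cong (λ x → 2 * x + N) (∑-complement I adjacent? ∉⇒adjacent adjacent⇒∉ λ i j → [ c i Fin.≟ c j ]) ⟩
      2 * T + N
        ≡⟨ ℕ.+-comm _ N ⟩
      N + 2 * T
        ≡⟨ cong (_+ 2 * T) (∑-cong (allFin n) λ i → sym (h-diagonal i)) ⟩
      ∑ (allFin n) (λ i → h i i) + 2 * T
        ≡⟨ sym (∑-symmetric h h-sym) ⟩
      ∑ (allFin n) (λ i → ∑ (allFin n) (h i))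
        ≡⟨ ∑-cong (allFin n) (λ i → ∑-cong (allFin n) λ j → trans (ℕ.*-comm [ adjacent? i j ] _)
             (cong ([ c i Fin.≟ c j ] *_) (same i j))) ⟩
      ∑ (allFin n) (λ i → ∑ (allFin n) λ j → [ c i Fin.≟ c j ] * [ blockAdjacent? (blockOf i) (blockOf j) ])
        ≡⟨ sym (∑-profile-pairs blockOf c λ u v → [ blockAdjacent? u v ]) ⟩
      ∑ (allFin p) (λ s → ∑ (allFin r) λ u → ∑ (allFin r) λ v →
        [ blockAdjacent? u v ] * (profile blockOf c u s * profile blockOf c v s))
        ≡⟨ sym (2*exponent (profile blockOf c)) ⟩
      2 * exponent (profile blockOf c) + ∑ (allFin p) (λ s → ∑ (allFin r) λ u → profile blockOf c u s)
        ≡⟨ cong (_+_ (2 * exponent (profile blockOf c))) (∑∑-profile blockOf c) ⟩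
      2 * exponent (profile blockOf c) + N ∎))
      where
      N : ℕ
      N = ∑ (allFin n) λ _ → 1
      h : Fin n → Fin n → ℕ
      h i j = [ adjacent? i j ] * [ c i Fin.≟ c j ]
      T : ℕ
      T = ∑ (allFin n) λ i → ∑ (allFin n) λ j → [ i Fin.<? j ] * h i j
      h-diagonal : ∀ i → h i i ≡ 1
      -- Fullness enters here: each vertex lies in a simple root outside `I`, so its signature is
      -- nonempty and the diagonal sums to `N`.
      h-diagonal i = cong₂ _*_ ([]-true (adjacent? i i) (adjacent-refl I n≥2 full i)) ([]-true (c i Fin.≟ c i) refl)
      h-sym : ∀ i j → h i j ≡ h j i
      h-sym i j = cong₂ _*_
        ([]-cong (adjacent? i j) (adjacent? j i) (adjacent-sym {i} {j}) (adjacent-sym {j} {i}))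
        ([]-cong (c i Fin.≟ c j) (c j Fin.≟ c i) sym sym)
      same : ∀ i j → [ adjacent? i j ] ≡ [ blockAdjacent? (blockOf i) (blockOf j) ]
      same i j = cong₂ (λ S T → [ nonempty? (S ∩ T) ]) (sym (s-min i)) (sym (s-min j))

open MonochromaticEdges

-- Scalars, primes and families

-- Normalised fractions do not compute for variable numerators and denominators; unnormalised sums
-- and products do, so the arithmetic is done there.
fromℚᵘ-+ : ∀ p q → ℚ.fromℚᵘ (p ℚᵘ.+ q) ≡ ℚ.fromℚᵘ p ℚ.+ ℚ.fromℚᵘ q
fromℚᵘ-+ p q = ℚ.toℚᵘ-injective (ℚᵘ.≃-trans (ℚ.toℚᵘ-fromℚᵘ (p ℚᵘ.+ q)) (ℚᵘ.≃-sym
  (ℚᵘ.≃-trans (ℚ.toℚᵘ-homo-+ (ℚ.fromℚᵘ p) (ℚ.fromℚᵘ q)) (ℚᵘ.+-cong (ℚ.toℚᵘ-fromℚᵘ p) (ℚ.toℚᵘ-fromℚᵘ q)))))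

fromℚᵘ-* : ∀ p q → ℚ.fromℚᵘ (p ℚᵘ.* q) ≡ ℚ.fromℚᵘ p ℚ.* ℚ.fromℚᵘ q
fromℚᵘ-* p q = ℚ.toℚᵘ-injective (ℚᵘ.≃-trans (ℚ.toℚᵘ-fromℚᵘ (p ℚᵘ.* q)) (ℚᵘ.≃-sym
  (ℚᵘ.≃-trans (ℚ.toℚᵘ-homo-* (ℚ.fromℚᵘ p) (ℚ.fromℚᵘ q)) (ℚᵘ.*-cong (ℚ.toℚᵘ-fromℚᵘ p) (ℚ.toℚᵘ-fromℚᵘ q)))))

/1-+ : ∀ i j → (i ℤ.+ j) ℚ./ 1 ≡ i ℚ./ 1 ℚ.+ j ℚ./ 1
/1-+ i j = ≡.trans
  (cong (λ k → ℚ.fromℚᵘ (mkℚᵘ k 0)) (≡.sym (cong₂ ℤ._+_ (ℤ.*-identityʳ i) (ℤ.*-identityʳ j))))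
  (fromℚᵘ-+ (mkℚᵘ i 0) (mkℚᵘ j 0))

recip-inverse : ∀ z → z ≢ + 0 → recip z ℚ.* (z ℚ./ 1) ≡ ℚ.1ℚ
recip-inverse (+ zero)  z≢0 = contradiction ≡.refl z≢0
recip-inverse (+ suc d) _   = ≡.trans (≡.sym (fromℚᵘ-* (mkℚᵘ (+ 1) d) (mkℚᵘ (+ suc d) 0)))
  (ℚ.fromℚᵘ-cong {mkℚᵘ (+ 1) d ℚᵘ.* mkℚᵘ (+ suc d) 0} {ℚᵘ.1ℚᵘ}
    (*≡* (≡.trans (ℤ.*-identityʳ _) (cong (λ k → + 1 ℤ.* + k) (≡.sym (ℕ.*-identityʳ (suc d)))))))
recip-inverse -[1+ d ]  _   = ≡.trans (≡.sym (fromℚᵘ-* (mkℚᵘ -[1+ 0 ] d) (mkℚᵘ -[1+ d ] 0)))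
  (ℚ.fromℚᵘ-cong {mkℚᵘ -[1+ 0 ] d ℚᵘ.* mkℚᵘ -[1+ d ] 0} {ℚᵘ.1ℚᵘ}
    (*≡* (≡.trans (ℤ.*-identityʳ _) (cong (λ k → + 1 ℤ.* + k) (≡.sym (ℕ.*-identityʳ (suc d)))))))

oddPrime-suc : ∀ i → oddPrime i < oddPrime (suc i)
oddPrime-suc i = proj₁ (proj₂ (nextPrime (oddPrime i)))

oddPrime-mono-< : ∀ {i j} → i < j → oddPrime i < oddPrime j
oddPrime-mono-< {i} {suc j} (s≤s i≤j) = case ℕ.m≤n⇒m<n∨m≡n i≤j of λ
  { (inj₁ i<j)    → ℕ.<-trans (oddPrime-mono-< i<j) (oddPrime-suc j)
  ; (inj₂ ≡.refl) → oddPrime-suc i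
  }

oddPrime-injective : ∀ i j → oddPrime i ≡ oddPrime j → i ≡ j
oddPrime-injective i j e with ℕ.<-cmp i j
... | tri< i<j _ _ = contradiction e (ℕ.<⇒≢ (oddPrime-mono-< i<j))
... | tri≈ _ i≡j _ = i≡j
... | tri> _ _ j<i = contradiction (≡.sym e) (ℕ.<⇒≢ (oddPrime-mono-< j<i))

∈-choices⁻ : ∀ {X : Set} m (xs : Fin m → List X) {f} → f List.∈ choices m xs → ∀ i → f i List.∈ xs i
∈-choices⁻ (suc m) xs f∈ i with ∈-cartesianProductWith⁻ F._∷_ (xs zero) (choices m (xs ∘ suc)) f∈
∈-choices⁻ (suc m) xs f∈ zero    | x , g , x∈ , g∈ , ≡.refl = x∈
∈-choices⁻ (suc m) xs f∈ (suc i) | x , g , x∈ , g∈ , ≡.refl = ∈-choices⁻ m (xs ∘ suc) g∈ i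

families-row : ∀ {r} p (N : Fin r → ℕ) {a} → a List.∈ families p N → ∀ u → ∑ℕ (a u) ≡ N u
families-row {r} p N a∈ u = proj₂ (∈-filter⁻ (λ a → ∑ℕ a ℕ.≟ N u) {xs = choices p λ _ → upTo (suc (N u))}
  (∈-choices⁻ r (λ u → weakCompositions p (N u)) a∈ u))

module FamilySums {c ℓ} (R : CommutativeSemiring c ℓ) where

  open CommutativeSemiring R hiding (zero)
  open SemiringSums R
  open SetoidReasoning setoid

  ∑-upTo : ∀ {m n} → m < n → ∑ (upTo n) (λ k → [ k ℕ.≟ m ]) ≈ 1#
  ∑-upTo {m} {suc n} (s≤s m≤n) = trans (+-congˡ (reflexive (≡.trans
      (cong (λ ks → ∑ ks λ k → [ k ℕ.≟ m ]) (≡.sym (List.map-upTo suc n)))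
      (∑-map suc (upTo n) λ k → [ k ℕ.≟ m ]))))
    (rest m m≤n)
    where
    rest : ∀ m → m ≤ n → [ 0 ℕ.≟ m ] + ∑ (upTo n) (λ k → [ suc k ℕ.≟ m ]) ≈ 1#
    rest zero    _   = trans (+-congˡ (∑-0 (upTo n))) (+-identityʳ 1#)
    rest (suc m) m<n = trans (+-identityˡ _) (∑-upTo m<n)

  ∑-weakCompositions : ∀ {p} N (α : Fin p → ℕ) → ∑ℕ α ≡ N →
    ∑ (weakCompositions p N) (λ x → [ Fin.all? (λ s → x s ℕ.≟ α s) ]) ≈ 1#
  ∑-weakCompositions {p} N α ∑α = begin
    ∑ (weakCompositions p N) (λ x → [ x≗α? x ])
      ≈⟨ ∑-filter (λ x → ∑ℕ x ℕ.≟ N) (choices p λ _ → upTo (suc N)) (λ x → [ x≗α? x ]) ⟩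
    ∑ (choices p λ _ → upTo (suc N)) (λ x → [ ∑ℕ x ℕ.≟ N ] * [ x≗α? x ])
      ≈⟨ ∑-cong (choices p λ _ → upTo (suc N)) (λ x → trans (*-comm _ _)
           (trans ([]-*-cong (x≗α? x) λ x≗α → []-true (∑ℕ x ℕ.≟ N) (∑x x x≗α)) (*-identityʳ _))) ⟩
    ∑ (choices p λ _ → upTo (suc N)) (λ x → [ x≗α? x ])
      ≈⟨ ∑-choices-∀ p (λ _ → upTo (suc N)) (λ s k → k ℕ.≟ α s) ⟩
    ∏ (allFin p) (λ s → ∑ (upTo (suc N)) λ k → [ k ℕ.≟ α s ])
      ≈⟨ ∏-cong (allFin p) (λ s → ∑-upTo (s≤s (α≤N s))) ⟩
    ∏ (allFin p) (λ _ → 1#)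
      ≈⟨ ∏-1 (allFin p) ⟩
    1# ∎
    where
    x≗α? : ∀ x → Dec (∀ s → x s ≡ α s)
    x≗α? x = Fin.all? λ s → x s ℕ.≟ α s
    ∑x : ∀ x → (∀ s → x s ≡ α s) → ∑ℕ x ≡ N
    ∑x x h = ≡.trans (≡.trans (∑ℕ≡∑ x) (≡.trans (ℕΣ.∑-cong (allFin p) h) (≡.sym (∑ℕ≡∑ α)))) ∑α
    α≤N : ∀ s → α s ≤ N
    α≤N s = ℕ.≤-trans (term≤∑ α s) (ℕ.≤-reflexive (≡.trans (≡.sym (∑ℕ≡∑ α)) ∑α))

  ∑-families : ∀ {r p} (N : Fin r → ℕ) (α : Fin r → Fin p → ℕ) → (∀ u → ∑ℕ (α u) ≡ N u) →
               ∑ (families p N) (λ a → [ a ≐? α ]) ≈ 1#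
  ∑-families {r} {p} N α rows = trans
    (∑-choices-∀ r (λ u → weakCompositions p (N u)) λ u x → Fin.all? λ s → x s ℕ.≟ α u s)
    (trans (∏-cong (allFin r) λ u → ∑-weakCompositions (N u) (α u) (rows u)) (∏-1 (allFin r)))

module ℕEmbedding {c ℓ} (K : ℚAlgebra c ℓ) where

  open ℚAlgebra K hiding (∑; ∏; _^_)
  open CommutativeRing commutativeRing using (refl; sym; trans)
  open SemiringSums commutativeSemiring
  open RingMorphisms.IsRingHomomorphism ι-hom
    using (+-homo; *-homo; -‿homo; 0#-homo; 1#-homo; ⟦⟧-cong)

  ιℕ-0 : ιℕ 0 ≈ 0#
  ιℕ-0 = 0#-homo

  ιℕ-1 : ιℕ 1 ≈ 1#
  ιℕ-1 = 1#-homo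

  ιℕ-+ : ∀ a b → ιℕ (a ℕ.+ b) ≈ ιℕ a + ιℕ b
  ιℕ-+ a b = trans (⟦⟧-cong (/1-+ (+ a) (+ b))) (+-homo _ _)

  ιℕ-∑ : ∀ {X : Set} (xs : List X) (f : X → ℕ) → ιℕ (ℕΣ.∑ xs f) ≈ ∑ xs (ιℕ ∘ f)
  ιℕ-∑ []       f = ιℕ-0
  ιℕ-∑ (x ∷ xs) f = trans (ιℕ-+ (f x) _) (+-congˡ (ιℕ-∑ xs f))

  ιℕ-[] : ∀ {P : Set} (P? : Dec P) → ιℕ ℕΣ.[ P? ] ≈ [ P? ]
  ιℕ-[] (yes _) = ιℕ-1
  ιℕ-[] (no _)  = ιℕ-0

  ιℕ≈∑1 : ∀ p → ιℕ p ≈ ∑ (allFin p) (λ _ → 1#)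
  ιℕ≈∑1 p = trans (⟦⟧-cong (cong (λ m → + m ℚ./ 1) (≡.sym (∑-1 p))))
    (trans (ιℕ-∑ (allFin p) λ _ → 1) (∑-cong (allFin p) λ _ → ιℕ-1))

  -- The difference is inverted in ℚ, where distinct integers suffice, and then mapped into the
  -- algebra.
  ι-recip : ∀ a b → a ≢ b → ι (recip (+ a ℤ.- + b)) * (ιℕ a - ιℕ b) ≈ 1#
  ι-recip a b a≢b = trans (*-congˡ difference)
    (trans (sym (*-homo _ _)) (trans (⟦⟧-cong (recip-inverse (+ a ℤ.- + b) nonzero)) 1#-homo))
    where
    nonzero : + a ℤ.- + b ≢ + 0
    nonzero e = a≢b (ℤ.+-injective (ℤ.i-j≡0⇒i≡j (+ a) (+ b) e))
    a≡ : + a ≡ (+ a ℤ.- + b) ℤ.+ + b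
    a≡ = ≡.sym (≡.trans (ℤ.+-assoc (+ a) (ℤ.- + b) (+ b))
      (≡.trans (cong (ℤ._+_ (+ a)) (ℤ.+-inverseˡ (+ b))) (ℤ.+-identityʳ (+ a))))
    difference : ιℕ a - ιℕ b ≈ ι ((+ a ℤ.- + b) ℚ./ 1)
    difference = trans
      (+-congʳ (trans (⟦⟧-cong (≡.trans (cong (ℚ._/ 1) a≡) (/1-+ (+ a ℤ.- + b) (+ b)))) (+-homo _ _)))
      (trans (+-assoc _ _ _) (trans (+-congˡ (-‿inverseʳ _)) (+-identityʳ _)))

  ι-recip-self : ∀ p → p ≢ 0 → ι (recip (+ p)) * ιℕ p ≈ 1#
  ι-recip-self p p≢0 = trans (sym (*-homo _ _))
    (trans (⟦⟧-cong (recip-inverse (+ p) (p≢0 ∘ ℤ.+-injective))) 1#-homo)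

-- Tutte and coboundary polynomials

-- This repeats the local edge map of `𝒜`, so that ranks in `𝒜 I` unfold to `Blocks.d (ends I)`.
ends : ∀ {n} (I : Ideal n) → Fin (List.length (complement I)) → Fin n × Fin n
ends I k = lo (List.lookup (complement I) k) , hi (List.lookup (complement I) k)

label-root : ∀ {n} (I : Ideal n) α → ¬ mem I α → Blocks.label (ends I) ⊤ (lo α) ≡ Blocks.label (ends I) ⊤ (hi α)
label-root I α α∉I = edge (∈-filter⁺ (λ α → ¬? (mem? I α)) (∈-allRoots α) α∉I)
  where
  open Blocks (ends I) ⊤
  edge : α List.∈ complement I → label (lo α) ≡ label (hi α)
  edge α∈ = subst (λ β → label (lo β) ≡ label (hi β)) (≡.sym (Any.lookup-index α∈)) (label-edge (Any.index α∈) ∈⊤)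

-- Fullness provides every simple root, and these form a path through all vertices; hence only the
-- constant vectors remain and the full rank is `n ∸ 1`.
d-⊤ : ∀ {n} (I : Ideal n) → 1 ≤ n → Full I → Blocks.d (ends I) ⊤ ≡ 1
d-⊤ {suc n} I _ full = connected⇒d≡1 zero
  (Fin.<-weakInduction (λ j → label j ≡ label zero) ≡.refl λ j h →
    ≡.trans (≡.sym (label-root I (step j) (full (step j) (cong suc (≡.sym (Fin.toℕ-inject₁ j)))))) h)
  where
  open Blocks (ends I) ⊤
  step : Fin n → Root (suc n)
  step j = root (Fin.inject₁ j) (suc j) (s≤s (ℕ.≤-reflexive (Fin.toℕ-inject₁ j)))

module Ranks {n} (I : Ideal n) (n≥1 : 1 ≤ n) (fullI : Full I) where

  open Arrangement (𝒜 I) public using (size; rank; full)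

  d : Subset size → ℕ
  d = Blocks.d (ends I)

  d≥1 : ∀ B → 1 ≤ d B
  d≥1 B = Blocks.d≥1 (ends I) B n≥1

  rank-full : rank full ≡ n ∸ 1
  rank-full = cong (n ∸_) (d-⊤ I n≥1 fullI)

  rank≤rank-full : ∀ B → rank B ≤ rank full
  rank≤rank-full B = ℕ.≤-trans (ℕ.∸-monoʳ-≤ n (d≥1 B)) (ℕ.≤-reflexive (≡.sym rank-full))

  rank≤∣∣ : ∀ B → rank B ≤ ∣ B ∣
  rank≤∣∣ B = ℕ.m≤n+o⇒m∸n≤o n (d B) (n≤d+∣B∣ (ends I) B)

  -- The off-by-one behind the factor 1/p: the corank of `B` is one less than the dimension that
  -- counts colourings. It also bounds the degree of the coboundary polynomial below `n`.
  suc-corank : ∀ B → suc (rank full ∸ rank B) ≡ d B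
  suc-corank B = ≡.trans (cong (λ r → suc (r ∸ rank B)) rank-full)
    (≡.trans (≡.sym (ℕ.+-∸-assoc 1 (ℕ.∸-monoʳ-≤ n (d≥1 B))))
    (≡.trans (cong (_∸ rank B) (ℕ.m+[n∸m]≡n n≥1)) (ℕ.m∸[m∸n]≡n (Blocks.d≤n (ends I) B))))

  corank<n : ∀ B → rank full ∸ rank B < n
  corank<n B = ℕ.≤-trans (ℕ.≤-reflexive (suc-corank B)) (Blocks.d≤n (ends I) B)

module TutteAndCoboundary {c ℓ} (K : ℚAlgebra c ℓ) {n} (n≥2 : 2 ≤ n) (I : Ideal n) (fullI : Full I) where

  n≥1 : 1 ≤ n
  n≥1 = ℕ.≤-trans (s≤s z≤n) n≥2

  open ℚAlgebra K hiding (∑; ∏; _^_)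
  open CommutativeRing commutativeRing using (refl; sym; trans)
  open SemiringSums commutativeSemiring
  open Interpolation K
  open ℕEmbedding K
  open SetoidReasoning setoid
  open Ranks I n≥1 fullI
  open import Algebra.Properties.CommutativeSemiring.Exp commutativeSemiring using (^-distrib-*)
  open import Algebra.Properties.CommutativeSemigroup *-commutativeSemigroup using (interchange; x∙yz≈y∙xz)

  coboundary-degree : ∀ t → DegreeBelow n (λ q → coboundary (𝒜 I) q t)
  coboundary-degree t = deg-∑ n (allSubsets size) λ B →
    deg-resp n (λ q → *-comm _ _) (deg-* n ((t - 1#) ^ ∣ B ∣) (deg-^ (corank<n B)))

  -- Multiplying by the power of `y - 1#` instead of dividing keeps this valid for every `y`.
  -- Termwise it is an identity of exponents, which survives truncation because `rank B` is at most
  -- both `rank full` and `∣ B ∣`.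
  tutte-coboundary : ∀ x y → (y - 1#) ^ (n ∸ 1) * tutte (𝒜 I) x y ≈ coboundary (𝒜 I) ((x - 1#) * (y - 1#)) y
  tutte-coboundary x y = trans (sym (∑-*ˡ _ (allSubsets size) _)) (∑-cong (allSubsets size) term)
    where
    X Y : Carrier
    X = x - 1#
    Y = y - 1#
    exponents : ∀ {ρ R b} → ρ ≤ R → ρ ≤ b → R +ℕ (b ∸ ρ) ≡ (R ∸ ρ) +ℕ b
    exponents {ρ} {R} {b} ρ≤R ρ≤b = ≡.trans (cong (_+ℕ (b ∸ ρ)) (≡.sym (ℕ.m∸n+n≡m ρ≤R)))
      (≡.trans (ℕ.+-assoc (R ∸ ρ) ρ (b ∸ ρ)) (cong ((R ∸ ρ) +ℕ_) (ℕ.m+[n∸m]≡n ρ≤b)))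
    term : ∀ B → Y ^ (n ∸ 1) * (X ^ (rank full ∸ rank B) * Y ^ (∣ B ∣ ∸ rank B)) ≈
                 (X * Y) ^ (rank full ∸ rank B) * Y ^ ∣ B ∣
    term B = begin
      Y ^ (n ∸ 1) * (X ^ k * Y ^ (∣ B ∣ ∸ rank B))
        ≈⟨ x∙yz≈y∙xz _ _ _ ⟩
      X ^ k * (Y ^ (n ∸ 1) * Y ^ (∣ B ∣ ∸ rank B))
        ≈⟨ *-congˡ (sym (^-homo-* Y (n ∸ 1) (∣ B ∣ ∸ rank B))) ⟩
      X ^ k * Y ^ ((n ∸ 1) +ℕ (∣ B ∣ ∸ rank B))
        ≡⟨ cong (λ m → X ^ k * Y ^ m) (≡.trans (cong (_+ℕ (∣ B ∣ ∸ rank B)) (≡.sym rank-full))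
             (exponents (rank≤rank-full B) (rank≤∣∣ B))) ⟩
      X ^ k * Y ^ (k +ℕ ∣ B ∣)
        ≈⟨ *-congˡ (^-homo-* Y k ∣ B ∣) ⟩
      X ^ k * (Y ^ k * Y ^ ∣ B ∣)
        ≈⟨ sym (*-assoc _ _ _) ⟩
      (X ^ k * Y ^ k) * Y ^ ∣ B ∣
        ≈⟨ *-congʳ (sym (^-distrib-* X Y k)) ⟩
      (X * Y) ^ k * Y ^ ∣ B ∣ ∎
      where
      k : ℕ
      k = rank full ∸ rank B

  tutte-interpolated : ∀ x y [y-1]⁻¹ → [y-1]⁻¹ * (y - 1#) ≈ 1# →
    tutte (𝒜 I) x y ≈ [y-1]⁻¹ ^ (n ∸ 1) *
      ∑ (allFin n) (λ i → ∏ (others i) (λ j →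
        ((x - 1#) * (y - 1#) - ιℕ (𝐩 j)) * ι (recip (+ 𝐩 i -ℤ + 𝐩 j))) * coboundary (𝒜 I) (ιℕ (𝐩 i)) y)
  tutte-interpolated x y w wY = begin
    tutte (𝒜 I) x y
      ≈⟨ sym (*-identityˡ _) ⟩
    1# * tutte (𝒜 I) x y
      ≈⟨ *-congʳ (sym (trans (sym (^-distrib-* w (y - 1#) (n ∸ 1))) (trans (^-congˡ (n ∸ 1) wY) (1^ (n ∸ 1))))) ⟩
    (w ^ (n ∸ 1) * (y - 1#) ^ (n ∸ 1)) * tutte (𝒜 I) x y
      ≈⟨ *-assoc _ _ _ ⟩
    w ^ (n ∸ 1) * ((y - 1#) ^ (n ∸ 1) * tutte (𝒜 I) x y)
      -- The interpolated function is `coboundary (𝒜 I) q y` in the variable `q`, evaluated at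
      -- `(x - 1#) * (y - 1#)`; its nodes are distinct because `oddPrime` is strictly increasing.
      ≈⟨ *-congˡ (trans (tutte-coboundary x y)
           (interpolation n (λ i → ιℕ (𝐩 i)) (λ i j → ι (recip (+ 𝐩 i -ℤ + 𝐩 j)))
             (λ i j i≢j → ι-recip (𝐩 i) (𝐩 j) λ e →
               i≢j (Fin.toℕ-injective (ℕ.suc-injective (oddPrime-injective (suc (toℕ i)) (suc (toℕ j)) e))))
             (λ q → coboundary (𝒜 I) q y) (coboundary-degree y) ((x - 1#) * (y - 1#)))) ⟩
    w ^ (n ∸ 1) * ∑ (allFin n) (λ i → ∏ (others i) (λ j →
        ((x - 1#) * (y - 1#) - ιℕ (𝐩 j)) * ι (recip (+ 𝐩 i -ℤ + 𝐩 j))) * coboundary (𝒜 I) (ιℕ (𝐩 i)) y) ∎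
    where
    open import Algebra.Properties.Semiring.Exp semiring using (^-congˡ)
    1^ : ∀ m → 1# ^ m ≈ 1#
    1^ zero    = refl
    1^ (suc m) = trans (*-identityˡ _) (1^ m)

  module _ (P : Accordance I) where

    open PartitionBy P
    open Monochromatic I n≥2 fullI P
    open SubsetSums commutativeSemiring
    open FamilySums commutativeSemiring

    coboundary-colourings : ∀ p t → ιℕ p * coboundary (𝒜 I) (ιℕ p) t ≈
                            ∑ (colourings n p) (λ c → t ^ monochromatic c)
    coboundary-colourings p t = begin
      ιℕ p * coboundary (𝒜 I) (ιℕ p) t
        ≈⟨ sym (∑-*ˡ (ιℕ p) (allSubsets size) _) ⟩
      ∑ (allSubsets size) (λ B → ιℕ p * (ιℕ p ^ (rank full ∸ rank B) * z ^ ∣ B ∣))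
        ≈⟨ ∑-cong (allSubsets size) colour-subset ⟩
      ∑ (allSubsets size) (λ B → ∑ (colourings n p) λ c → [ respects? (ends I) B c ] * z ^ ∣ B ∣)
        ≈⟨ ∑-swap (allSubsets size) (colourings n p) _ ⟩
      ∑ (colourings n p) (λ c → ∑ (allSubsets size) λ B → [ respects? (ends I) B c ] * z ^ ∣ B ∣)
        ≈⟨ ∑-cong (colourings n p) subsets-of-monochromatic ⟩
      ∑ (colourings n p) (λ c → t ^ monochromatic c) ∎
      where
      z : Carrier
      z = t - 1#
      colour-subset : ∀ B → ιℕ p * (ιℕ p ^ (rank full ∸ rank B) * z ^ ∣ B ∣) ≈
                            ∑ (colourings n p) (λ c → [ respects? (ends I) B c ] * z ^ ∣ B ∣)
      colour-subset B = begin
        ιℕ p * (ιℕ p ^ (rank full ∸ rank B) * z ^ ∣ B ∣)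
          ≈⟨ sym (*-assoc _ _ _) ⟩
        ιℕ p ^ suc (rank full ∸ rank B) * z ^ ∣ B ∣
          ≡⟨ cong (λ k → ιℕ p ^ k * z ^ ∣ B ∣) (suc-corank B) ⟩
        ιℕ p ^ d B * z ^ ∣ B ∣
          ≈⟨ *-congʳ (trans (^-cong {x = ιℕ p} (ιℕ≈∑1 p) (≡.refl {x = d B})) (sym (count-respecting (ends I) B p))) ⟩
        ∑ (colourings n p) (λ c → [ respects? (ends I) B c ]) * z ^ ∣ B ∣
          ≈⟨ sym (∑-*ʳ (z ^ ∣ B ∣) (colourings n p) _) ⟩
        ∑ (colourings n p) (λ c → [ respects? (ends I) B c ] * z ^ ∣ B ∣) ∎
      subsets-of-monochromatic : ∀ c →
        ∑ (allSubsets size) (λ B → [ respects? (ends I) B c ] * z ^ ∣ B ∣) ≈ t ^ monochromatic c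
      subsets-of-monochromatic c = begin
        ∑ (allSubsets size) (λ B → [ respects? (ends I) B c ] * z ^ ∣ B ∣)
          ≈⟨ ∑-allSubsets size mono? z ⟩
        ∏ (allFin size) (λ k → 1# + [ mono? k ] * z)
          -- An edge contributes `1# + (t - 1#)` if it is monochromatic and `1#` otherwise, which is
          -- `t` to the power of its bracket.
          ≈⟨ ∏-cong (allFin size) (λ k → edge-factor (mono? k)) ⟩
        ∏ (allFin size) (λ k → t ^ ℕΣ.[ mono? k ])
          ≈⟨ ∏-^ t (λ k → ℕΣ.[ mono? k ]) ⟩
        t ^ ∑ℕ (λ k → ℕΣ.[ mono? k ])
          ≡⟨ cong (t ^_) (≡.trans (∑ℕ≡∑ λ k → ℕΣ.[ mono? k ])
               (ℕΣ.∑-lookup (complement I) λ α → ℕΣ.[ c (lo α) Fin.≟ c (hi α) ])) ⟩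
        t ^ monochromatic c ∎
        where
        mono? : ∀ k → Dec (c (proj₁ (ends I k)) ≡ c (proj₂ (ends I k)))
        mono? k = c (proj₁ (ends I k)) Fin.≟ c (proj₂ (ends I k))
        edge-factor : ∀ {A : Set} (A? : Dec A) → 1# + [ A? ] * z ≈ t ^ ℕΣ.[ A? ]
        edge-factor (yes _) = begin
          1# + 1# * (t - 1#)   ≈⟨ +-congˡ (*-identityˡ _) ⟩
          1# + (t - 1#)        ≈⟨ trans (+-comm _ _) (+-assoc _ _ _) ⟩
          t + (- 1# + 1#)      ≈⟨ +-congˡ (-‿inverseˡ 1#) ⟩
          t + 0#               ≈⟨ +-identityʳ t ⟩
          t                    ≈⟨ sym (*-identityʳ t) ⟩
          t * 1#               ∎
        edge-factor (no _)  = trans (+-congˡ (zeroˡ z)) (+-identityʳ 1#)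

    -- Colourings are grouped by profile: each matches exactly one listed family, and on a match the
    -- exponent may be read off the family instead of the colouring. After the exchange of sums the
    -- inner sum counts the colourings with a given profile.
    colourings-families : ∀ p t → ∑ (colourings n p) (λ c → t ^ monochromatic c) ≈
      ∑ (families p λ u → ∣ block u ∣) (λ a →
        ιℕ (∏ℕ λ u → multinomial ∣ block u ∣ (a u)) * t ^ exponent a)
    colourings-families p t = begin
      ∑ 𝓒 (λ c → t ^ monochromatic c)
        ≈⟨ ∑-cong 𝓒 (λ c → trans (sym (*-identityˡ _)) (*-congʳ (sym (∑-families N (prof c) (rows c))))) ⟩
      ∑ 𝓒 (λ c → ∑ 𝓕 (λ a → [ a ≐? prof c ]) * t ^ monochromatic c)
        ≈⟨ ∑-cong 𝓒 (λ c → trans (sym (∑-*ʳ (t ^ monochromatic c) 𝓕 λ a → [ a ≐? prof c ]))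
             (∑-cong 𝓕 λ a → []-*-cong (a ≐? prof c) λ a≐ → reflexive (cong (t ^_)
               (≡.trans (monochromatic≡exponent c) (≡.sym (exponent-cong a≐)))))) ⟩
      ∑ 𝓒 (λ c → ∑ 𝓕 λ a → [ a ≐? prof c ] * t ^ exponent a)
        ≈⟨ ∑-swap 𝓒 𝓕 _ ⟩
      ∑ 𝓕 (λ a → ∑ 𝓒 λ c → [ a ≐? prof c ] * t ^ exponent a)
        -- Membership in `𝓕` supplies the row sums that the multinomial count requires.
        ≈⟨ ∑-cong-∈ 𝓕 (λ {a} a∈ → trans (∑-*ʳ (t ^ exponent a) 𝓒 λ c → [ a ≐? prof c ])
             (*-congʳ (counted a a∈))) ⟩
      ∑ 𝓕 (λ a → ιℕ (∏ℕ λ u → multinomial (N u) (a u)) * t ^ exponent a) ∎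
      where
      N : Fin r → ℕ
      N u = ∣ block u ∣
      𝓒 : List (Fin n → Fin p)
      𝓒 = colourings n p
      𝓕 : List (Fin r → Fin p → ℕ)
      𝓕 = families p N
      prof : (Fin n → Fin p) → Fin r → Fin p → ℕ
      prof = profile blockOf
      rows : ∀ c u → ∑ℕ (prof c u) ≡ N u
      rows c u = ≡.trans (∑ℕ≡∑ (prof c u)) (≡.trans (profile-row blockOf c u) (≡.sym (∣block∣ u)))
      counted : ∀ a → a List.∈ 𝓕 → ∑ 𝓒 (λ c → [ a ≐? prof c ]) ≈ ιℕ (∏ℕ λ u → multinomial (N u) (a u))
      counted a a∈ = trans (sym (trans (ιℕ-∑ 𝓒 λ c → ℕΣ.[ a ≐? prof c ]) (∑-cong 𝓒 λ c → ιℕ-[] (a ≐? prof c))))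
        (reflexive (cong ιℕ (≡.trans
          (count-multinomial blockOf a λ u →
            ≡.trans (≡.sym (∑ℕ≡∑ (a u))) (≡.trans (families-row p N a∈ u) (∣block∣ u)))
          (≡.trans (∏ℕ≡∏ λ u → multinomial (fibreSize blockOf u) (a u))
          (≡.trans (ℕΣ.∏-cong (allFin r) λ u → cong (λ m → multinomial m (a u)) (≡.sym (∣block∣ u)))
                   (≡.sym (∏ℕ≡∏ λ u → multinomial (N u) (a u))))))))

    coboundary-families : ∀ p → OddPrime p → ∀ t →
      coboundary (𝒜 I) (ιℕ p) t ≈ ι (recip (+ p)) *
        ∑ (families p λ u → ∣ block u ∣) (λ a →
          ιℕ (∏ℕ λ u → multinomial ∣ block u ∣ (a u)) * t ^ exponent a)
    coboundary-families p (p-prime , _) t = begin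
      coboundary (𝒜 I) (ιℕ p) t
        ≈⟨ sym (*-identityˡ _) ⟩
      1# * coboundary (𝒜 I) (ιℕ p) t
        ≈⟨ *-congʳ (sym (ι-recip-self p (ℕ.≢-nonZero⁻¹ p {{prime⇒nonZero p-prime}}))) ⟩
      (ι (recip (+ p)) * ιℕ p) * coboundary (𝒜 I) (ιℕ p) t
        ≈⟨ *-assoc _ _ _ ⟩
      ι (recip (+ p)) * (ιℕ p * coboundary (𝒜 I) (ιℕ p) t)
        ≈⟨ *-congˡ (trans (coboundary-colourings p t) (colourings-families p t)) ⟩
      ι (recip (+ p)) * ∑ (families p λ u → ∣ block u ∣) (λ a →
        ιℕ (∏ℕ λ u → multinomial ∣ block u ∣ (a u)) * t ^ exponent a) ∎

mainTheorem12 : ∀ {c ℓ} (K : ℚAlgebra c ℓ) → let open ℚAlgebra K in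
    ∀ n → 2 ≤ n → (I : Ideal n) → Full I →
    (∀ x y [y-1]⁻¹ → [y-1]⁻¹ * (y - 1#) ≈ 1# →
    tutte (𝒜 I) x y
    ≈ [y-1]⁻¹ ^ (n ∸ 1) *
    (∑[ i ∈ allFin n ]
    (∏[ j ∈ others i ]
    (((x - 1#) * (y - 1#) - ιℕ (𝐩 j)) * ι (recip (+ 𝐩 i -ℤ + 𝐩 j))))
    * coboundary (𝒜 I) (ιℕ (𝐩 i)) y))
    ×
    ((P : Accordance I) → let open PartitionBy P in
    ∀ p → OddPrime p → ∀ t →
    coboundary (𝒜 I) (ιℕ p) t
    ≈ ι (recip (+ p)) *
    (∑[ a ∈ families p (λ u → ∣ block u ∣) ]
    ιℕ (∏ℕ λ u → multinomial ∣ block u ∣ (a u))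
    * t ^ (∑ℕ λ u → ∑ℕ λ s →
    (a u s C 2) +ℕ a u s *ℕ sum (map (λ v → a v s) (R I P u)))))
mainTheorem12 K n n≥2 I fullI = tutte-interpolated , coboundary-families
  where open TutteAndCoboundary K n≥2 I fullI
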